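{- For integers $\nu\ge1$ and $n\ge(\nu+1)^2$, \[ (-1)^\nu\left(pp(2n)+2\sum_{\tau=1}^{\nu}(-1)^\tau pp(2n-\tau^2)\right)=(-1)^\nu p(n)+2\,pp_e(2n) \] and \[ (-1)^\nu\left(pp(2n+1)+2\sum_{\tau=1}^{\nu}(-1)^\tau pp(2n+1-\tau^2)\right)=2\,pp_e(2n+1). \]
   Context: $p(n)$ is the number of partitions of $n$; $pp(n)$ is the number of bipartitions of $n$, i.e. pairs $(\pi_1,\pi_2)$ of partitions with $|\pi_1|+|\pi_2|=n$, where $|\pi|$ denotes the sum of parts. Definition of $M(a,m,\nu;n)$ (integers $\nu\ge0$, $1\le a<m$, $n\ge0$): for a partition $\lambda_1\ge\dots\ge\lambda_k$ of $n$ into parts $\equiv a\pmod m$, put $\ell_i=(\lambda_i-a)/m+1$ (number of boxes of the row of $\lambda_i$ in the $m$-modular Young diagram), and let $t$ be the largest integer $0\le t\le k$ with $\ell_t\ge t+\nu+2$ (height of the $(\nu+2)$-Durfee rectangle, of width $t+\nu+2$). $M(a,m,\nu;n)$ counts partitions of $n$ into parts $\equiv a\pmod m$ in which each of $a,a+m,\dots,a+m\nu$ occurs at least once and $\ell_i<t+\nu+2$ for all $i>t$. Definition (depending on $\nu$): $pp_e(n)$ counts bipartitions $(\pi_1,\pi_2)$ of $n$ such that $\pi_1$ is an arbitrary partition and, if $\alpha$ is the sum of the even parts of $\pi_2$, the odd parts of $\pi_2$ form a partition counted by $M(1,2,\nu;n-|\pi_1|-\alpha)$. -}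

module Defs where

open import Data.Nat using (ℕ; zero; suc; _+_; _*_; _∸_; _≤ᵇ_; _<ᵇ_; _≡ᵇ_; NonZero)
open import Data.Nat.DivMod using (_/_; _%_)
open import Data.Bool using (Bool; true; false; if_then_else_; _∧_; not)
open import Data.List using (List; []; _∷_; length; map; concatMap; filter; drop; upTo; cartesianProduct)
open import Data.Bool.ListAction using (all; any)
open import Data.Product using (_×_; _,_; proj₁; proj₂)
open import Data.Integer as ℤ using (ℤ)
open import Relation.Nullary.Decidable using (Dec)
open import Data.Bool.Properties using (T?)
open import Data.Unit using (⊤)

-- partsLE fuel k n : all partitions of n with every part ≤ k
-- (as non-increasing lists of positive integers); fuel ≥ n suffices.
partsLE : ℕ → ℕ → ℕ → List (List ℕ)
partsLE fuel    k zero    = [] ∷ []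
partsLE zero    k (suc n) = []
partsLE (suc f) k (suc n) =
  concatMap (λ i → let j = suc i in
                   if j ≤ᵇ k then map (j ∷_) (partsLE f j (suc n ∸ j)) else [])
            (upTo (suc n))

partitions : ℕ → List (List ℕ)
partitions n = partsLE n n n

p : ℕ → ℕ
p n = length (partitions n)

bipartitions : ℕ → List (List ℕ × List ℕ)
bipartitions n =
  concatMap (λ k → cartesianProduct (partitions k) (partitions (n ∸ k)))
            (upTo (suc n))

pp : ℕ → ℕ
pp n = length (bipartitions n)

-- ℓ-values (row lengths of the m-modular Young diagram)
ells : (a m : ℕ) .{{_ : NonZero m}} → List ℕ → List ℕ
ells a m λs = map (λ x → suc ((x ∸ a) / m)) λs

-- durf ν i ℓs : largest (1-based) index t ≥ i of ℓs (whose head has index i)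
-- with ℓ_t ≥ t + ν + 2, or 0 if there is none
durf : ℕ → ℕ → List ℕ → ℕ
durf ν i [] = 0
durf ν i (l ∷ ls) with durf ν (suc i) ls
... | suc r = suc r
... | zero  = if (i + ν + 2) ≤ᵇ l then i else 0

-- height t of the (ν+2)-Durfee rectangle
durfeeHeight : ℕ → List ℕ → ℕ
durfeeHeight ν ℓs = durf ν 1 ℓs

M-ok : (a m ν : ℕ) .{{_ : NonZero m}} → List ℕ → Bool
M-ok a m ν λs =
  all (λ x → (x % m) ≡ᵇ a) λs
  ∧ all (λ j → any (λ x → x ≡ᵇ (a + m * j)) λs) (upTo (suc ν))
  ∧ all (λ l → l <ᵇ (t + ν + 2)) (drop t ℓs)
  where
  ℓs = ells a m λs
  t  = durfeeHeight ν ℓs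

M : (a m ν : ℕ) .{{_ : NonZero m}} → ℕ → ℕ
M a m ν n = length (filter (λ λs → T? (M-ok a m ν λs)) (partitions n))

odd? : ℕ → Bool
odd? x = (x % 2) ≡ᵇ 1

oddParts : List ℕ → List ℕ
oddParts = filter (λ x → T? (odd? x))

-- (π₁ , π₂) is counted by pp_e: the odd parts of π₂ form a partition
-- (of n - |π₁| - α, automatically) counted by M(1,2,ν; ·)
ppe-ok : ℕ → List ℕ × List ℕ → Bool
ppe-ok ν (π₁ , π₂) = M-ok 1 2 ν (oddParts π₂)

ppe : ℕ → ℕ → ℕ
ppe ν n = length (filter (λ b → T? (ppe-ok ν b)) (bipartitions n))

sum1to : ℕ → (ℕ → ℤ) → ℤ
sum1to zero    f = ℤ.+ 0
sum1to (suc ν) f = sum1to ν f ℤ.+ f (suc ν)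

{-# OPTIONS --safe #-}
module Submission where

-- Describe the odd parts of π₂ by the row lengths ℓ₁ ≥ ℓ₂ ≥ … of their 2-modular diagram; a row ℓ weighs
-- 2ℓ − 1.  With μ = ν + 1, the partitions counted by M(1,2,ν;·) are those whose rows contain 1,…,μ and
-- have no i with ℓᵢ = i + μ.
--
-- Let c(μ) be the number of bipartitions of N with such a π₂.  Then c(μ) + c(μ+1) = pp(N − μ²): adding one
-- row of each length 1,…,μ, of total weight μ², shows that the right side counts all π₂ whose rows contain
-- 1,…,μ, and those having a row ℓᵢ = i + μ correspond to the ones counted by c(μ+1): delete that row, of
-- weight 2(i + μ) − 1, lengthen each of the i − 1 rows above it by one box and add a row of length μ + 1.
-- Hence the theorem for ν follows from that for ν − 1, and only ν = 0 remains, that is,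
-- pp(N) = 2c(1) + [N even] p(N/2), where c(0) + c(1) = pp(N).
--
-- Sylvester's bijection turns the rows into a partition d into distinct parts, and some ℓᵢ = i exactly
-- if d has an odd number of parts.  Moving the largest part of (π₁, d) to the other component changes
-- that parity, so it matches c(0) with c(1) except at π₁ = d = ∅, where π₂ has only even parts.

open import Defs
open import Data.Bool using (Bool; true; false; if_then_else_; T; not)
open import Data.Bool.ListAction using (all; any)
open import Data.Bool.Properties using (T?; T-∧; not-involutive)
open import Data.Empty using (⊥; ⊥-elim)
import Data.Integer.Properties as ℤ
import Data.Integer.Tactic.RingSolver as ℤSolver
open import Data.List using (List; []; _∷_; _++_; length; map; concatMap; filter; foldr; drop; upTo; replicate; cartesianProduct)
open import Data.List.Membership.Propositional using (_∈_)
open import Data.List.Membership.Propositional.Properties using (∈-map⁺; ∈-map⁻; ∈-++⁺ˡ; ∈-++⁺ʳ; ∈-++⁻; ∈-filter⁺; ∈-filter⁻; ∈-upTo⁺; ∈-upTo⁻; ∈-cartesianProduct⁺; ∈-cartesianProduct⁻)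
open import Data.List.Membership.Propositional.Properties.WithK using (unique∧set⇒bag)
open import Data.List.Properties using (length-map; length-++; length-replicate; filter-accept; filter-reject)
open import Data.List.Relation.Binary.BagAndSetEquality using (∼bag⇒↭)
open import Data.List.Relation.Binary.Permutation.Propositional.Properties using (↭-length)
open import Data.List.Relation.Unary.All as All using (All; []; _∷_)
open import Data.List.Relation.Unary.All.Properties using (all⁺; all⁻; all-filter)
open import Data.List.Relation.Unary.AllPairs using ([]; _∷_)
open import Data.List.Relation.Unary.Any as Any using (here; there)
open import Data.List.Relation.Unary.Any.Properties using (any⁺; any⁻)
open import Data.List.Relation.Unary.Unique.Propositional using (Unique)
import Data.List.Relation.Unary.Unique.Propositional.Properties as Uniq
open import Data.Nat hiding (parity)
open import Data.Nat.DivMod using (m*n/n≡m; m*n%n≡0; [m+kn]%n≡m%n)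
open import Data.Nat.ListAction using (sum)
open import Data.Nat.Properties
open import Data.Nat.Tactic.RingSolver using (solve-∀)
open import Data.Product using (_×_; _,_; proj₁; proj₂; ∃-syntax)
open import Data.Sum using (_⊎_; inj₁; inj₂)
open import Data.Unit using (⊤; tt)
open import Function using (_∘_; id; mk⇔; Equivalence)
open import Relation.Binary.Definitions using (tri<; tri≈; tri>)
open import Relation.Binary.PropositionalEquality
open import Relation.Nullary using (¬_; yes; no; contradiction)
open import Relation.Unary using (Decidable; _∪_)

private variable
  A B : Set
  P Q : A → Set
  m n : ℕ

-- Counting by enumerations without repetition.

record Enum (P : A → Set) (xs : List A) : Set where
  field
    unique   : Unique xs
    sound    : ∀ {x} → x ∈ xs → P x
    complete : ∀ {x} → P x → x ∈ xs
open Enum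

Card : (A → Set) → ℕ → Set
Card P n = ∃[ xs ] Enum P xs × length xs ≡ n

-- Both maps are total on the ambient types and are mutually inverse only where `P` and `Q` hold, so
-- proofs of membership never have to be compared.
record _≅_ {A B : Set} (P : A → Set) (Q : B → Set) : Set where
  field
    to      : A → B
    from    : B → A
    to-ok   : ∀ {x} → P x → Q (to x)
    from-ok : ∀ {y} → Q y → P (from y)
    from-to : ∀ {x} → P x → from (to x) ≡ x
    to-from : ∀ {y} → Q y → to (from y) ≡ y
open _≅_

≅-sym : P ≅ Q → Q ≅ P
≅-sym b = record
  { to = from b ; from = to b ; to-ok = from-ok b ; from-ok = to-ok b
  ; from-to = to-from b ; to-from = from-to b }

⇔⇒≅ : {P Q : A → Set} → (∀ {x} → P x → Q x) → (∀ {x} → Q x → P x) → P ≅ Q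
⇔⇒≅ f g = record
  { to = id ; from = id ; to-ok = f ; from-ok = g
  ; from-to = λ _ → refl ; to-from = λ _ → refl }

Unique-map : {f : A → B} {xs : List A} → All P xs →
             (∀ {x y} → P x → P y → f x ≡ f y → x ≡ y) → Unique xs → Unique (map f xs)
Unique-map [] inj [] = []
Unique-map {f = f} (px ∷ pxs) inj (x∉ ∷ u) = go pxs x∉ ∷ Unique-map pxs inj u
  where
  go : ∀ {ys} → All _ ys → All (_ ≢_) ys → All (f _ ≢_) (map f ys)
  go [] [] = []
  go (py ∷ pys) (x≢y ∷ x∉) = (x≢y ∘ inj px py) ∷ go pys x∉

Enum-≅ : {P : A → Set} {Q : B → Set} {xs : List A} (b : P ≅ Q) → Enum P xs → Enum Q (map (to b) xs)
Enum-≅ {P = P} {Q = Q} {xs} b e = record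
  { unique = Unique-map {P = P} (All.tabulate (sound e)) inj (unique e)
  ; sound = sound′
  ; complete = λ qy → subst (_∈ map (to b) xs) (to-from b qy)
                        (∈-map⁺ (to b) (complete e (from-ok b qy))) }
  where
  inj : ∀ {x y} → P x → P y → to b x ≡ to b y → x ≡ y
  inj px py eq = trans (sym (from-to b px)) (trans (cong (from b) eq) (from-to b py))
  sound′ : ∀ {y} → y ∈ map (to b) xs → Q y
  sound′ y∈ with ∈-map⁻ (to b) y∈
  ... | x , x∈ , refl = to-ok b (sound e x∈)

Card-≅ : P ≅ Q → Card P n → Card Q n
Card-≅ b (xs , e , refl) = map (to b) xs , Enum-≅ b e , length-map (to b) xs

-- Duplicate-free lists with the same members are permutations of one another. The identities
-- `pp-ppe` and `pp-ppe₀` arise from counting one predicate in two ways.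
Card-unique : Card P m → Card P n → m ≡ n
Card-unique (xs , e , refl) (ys , e′ , refl) =
  ↭-length (∼bag⇒↭ (unique∧set⇒bag (unique e) (unique e′)
    (mk⇔ (complete e′ ∘ sound e) (complete e ∘ sound e′))))

Card-∪ : {P Q : A → Set} → (∀ {x} → P x → ¬ Q x) → Card P m → Card Q n → Card (P ∪ Q) (m + n)
Card-∪ {P = P} {Q = Q} dis (xs , e , refl) (ys , e′ , refl) = xs ++ ys , en , length-++ xs
  where
  en : Enum (P ∪ Q) (xs ++ ys)
  unique en = Uniq.++⁺ (unique e) (unique e′) (λ (x∈ , y∈) → dis (sound e x∈) (sound e′ y∈))
  sound en z∈ with ∈-++⁻ xs z∈
  ... | inj₁ x∈ = inj₁ (sound e x∈)
  ... | inj₂ y∈ = inj₂ (sound e′ y∈)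
  complete en (inj₁ p) = ∈-++⁺ˡ (complete e p)
  complete en (inj₂ q) = ∈-++⁺ʳ xs (complete e′ q)

Enum-filter : {P Q : A → Set} (Q? : Decidable Q) {xs : List A} → Enum P xs →
              Enum (λ x → P x × Q x) (filter Q? xs)
Enum-filter Q? e = record
  { unique = Uniq.filter⁺ Q? (unique e)
  ; sound = λ x∈ → let x∈xs , q = ∈-filter⁻ Q? x∈ in sound e x∈xs , q
  ; complete = λ (p , q) → ∈-filter⁺ Q? (complete e p) q }

Enum-cartesian : {P : A → Set} {Q : B → Set} {xs : List A} {ys : List B} → Enum P xs → Enum Q ys →
                 Enum (λ (x , y) → P x × Q y) (cartesianProduct xs ys)
Enum-cartesian {xs = xs} {ys} e e′ = record
  { unique = Uniq.cartesianProduct⁺ (unique e) (unique e′)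
  ; sound = λ z∈ → let x∈ , y∈ = ∈-cartesianProduct⁻ xs ys z∈ in sound e x∈ , sound e′ y∈
  ; complete = λ (p , q) → ∈-cartesianProduct⁺ (complete e p) (complete e′ q) }

-- The argument `key` says that an element determines its block, which keeps the blocks disjoint.
Enum-concatMap : {K : Set} {P : K → A → Set} {f : K → List A} {ks : List K} →
                 Unique ks → (∀ {k} → k ∈ ks → Enum (P k) (f k)) →
                 (∀ {k l x} → P k x → P l x → k ≡ l) →
                 Enum (λ x → ∃[ k ] k ∈ ks × P k x) (concatMap f ks)
Enum-concatMap {ks = []} u e key = record { unique = [] ; sound = λ () ; complete = λ { (_ , () , _) } }
Enum-concatMap {P = P} {f} {k ∷ ks} (k∉ ∷ u) e key = record
  { unique = Uniq.++⁺ (unique e₀) (unique es) disj ; sound = snd ; complete = cmp }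
  where
  e₀ = e (here refl)
  es = Enum-concatMap {P = P} u (e ∘ there) key
  disj : ∀ {x} → ¬ (x ∈ f k × x ∈ concatMap f ks)
  disj (x∈ , x∈′) with sound es x∈′
  ... | l , l∈ , pl = All.lookup k∉ l∈ (key (sound e₀ x∈) pl)
  snd : ∀ {x} → x ∈ f k ++ concatMap f ks → ∃[ l ] l ∈ k ∷ ks × P l x
  snd x∈ with ∈-++⁻ (f k) x∈
  ... | inj₁ x∈ = k , here refl , sound e₀ x∈
  ... | inj₂ x∈ = let l , l∈ , p = sound es x∈ in l , there l∈ , p
  cmp : ∀ {x} → (∃[ l ] l ∈ k ∷ ks × P l x) → x ∈ f k ++ concatMap f ks
  cmp (_ , here refl , p) = ∈-++⁺ˡ (complete e₀ p)
  cmp (l , there l∈ , p) = ∈-++⁺ʳ (f k) (complete es (l , l∈ , p))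

Enum-⇔ : {P Q : A → Set} {xs : List A} → (∀ {x} → P x → Q x) → (∀ {x} → Q x → P x) →
         Enum P xs → Enum Q xs
Enum-⇔ f g e = record { unique = unique e ; sound = f ∘ sound e ; complete = complete e ∘ g }

-- Partitions and bipartitions as enumerated predicates.

Desc : ℕ → List ℕ → Set
Desc b []       = ⊤
Desc b (x ∷ xs) = 1 ≤ x × x ≤ b × Desc x xs

Desc-weaken : ∀ {b c} xs → b ≤ c → Desc b xs → Desc c xs
Desc-weaken []       b≤c d              = tt
Desc-weaken (x ∷ xs) b≤c (1≤x , x≤b , d) = 1≤x , ≤-trans x≤b b≤c , d

-- Every part is at most the sum; this replaces the unspecified bound in `IsPart` by the bound `n`
-- built into `partitions`.
Desc-sum : ∀ {b} xs → Desc b xs → Desc (sum xs) xs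
Desc-sum []       d             = tt
Desc-sum (x ∷ xs) (1≤x , _ , d) = 1≤x , m≤m+n x (sum xs) , d

partsLE-enum : ∀ f k n → n ≤ f → Enum (λ xs → Desc k xs × sum xs ≡ n) (partsLE f k n)
partsLE-enum f k zero n≤f = record { unique = [] ∷ [] ; sound = λ { (here refl) → tt , refl } ; complete = cmp }
  where
  cmp : ∀ {xs} → Desc k xs × sum xs ≡ 0 → xs ∈ [] ∷ []
  cmp {[]} _ = here refl
  cmp {suc x ∷ xs} (_ , ())
partsLE-enum (suc f) k (suc n) (s≤s n≤f) =
  Enum-⇔ fwd bwd (Enum-concatMap {P = First} (Uniq.upTo⁺ (suc n)) enum key)
  where
  -- The partitions are sorted into blocks by their first part, as in the recursion of `partsLE`.
  First : ℕ → List ℕ → Set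
  First i []       = ⊥
  First i (x ∷ xs) = x ≡ suc i × suc i ≤ k × Desc (suc i) xs × sum xs ≡ n ∸ i
  F : ℕ → List (List ℕ)
  F i = if suc i ≤ᵇ k then map (suc i ∷_) (partsLE f (suc i) (n ∸ i)) else []
  enum : ∀ {i} → i ∈ upTo (suc n) → Enum (First i) (F i)
  enum {i} _ with suc i ≤ᵇ k in eq
  ... | true = Enum-≅ bij (partsLE-enum f (suc i) (n ∸ i) (≤-trans (m∸n≤m n i) n≤f))
    where
    i<k : suc i ≤ k
    i<k = ≤ᵇ⇒≤ (suc i) k (subst T (sym eq) tt)
    bij : (λ xs → Desc (suc i) xs × sum xs ≡ n ∸ i) ≅ First i
    to bij = suc i ∷_
    from bij [] = []
    from bij (x ∷ xs) = xs
    to-ok bij (d , s) = refl , i<k , d , s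
    from-ok bij {x ∷ xs} (_ , _ , d , s) = d , s
    from-to bij _ = refl
    to-from bij {x ∷ xs} (refl , _) = refl
  ... | false = record { unique = [] ; sound = λ () ; complete = cmp }
    where
    cmp : ∀ {xs} → First i xs → xs ∈ []
    cmp {x ∷ xs} (_ , i<k , _) = ⊥-elim (subst T eq (≤⇒≤ᵇ i<k))
  key : ∀ {i j xs} → First i xs → First j xs → i ≡ j
  key {xs = x ∷ xs} (refl , _) (eq , _) = suc-injective eq
  fwd : ∀ {xs} → (∃[ i ] i ∈ upTo (suc n) × First i xs) → Desc k xs × sum xs ≡ suc n
  fwd {x ∷ xs} (i , i∈ , refl , i<k , d , s) with ∈-upTo⁻ i∈
  ... | s≤s i≤n = (s≤s z≤n , i<k , d) , cong suc (trans (cong (i +_) s) (m+[n∸m]≡n i≤n))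
  bwd : ∀ {xs} → Desc k xs × sum xs ≡ suc n → ∃[ i ] i ∈ upTo (suc n) × First i xs
  bwd {suc i ∷ xs} ((_ , i<k , d) , s) =
    i , ∈-upTo⁺ (s≤s (subst (i ≤_) s′ (m≤m+n i (sum xs)))) , refl , i<k , d
      , trans (sym (m+n∸m≡n i (sum xs))) (cong (_∸ i) s′)
    where s′ = suc-injective s

IsPart : List ℕ → Set
IsPart xs = ∃[ b ] Desc b xs

partitions-enum : ∀ n → Enum (λ xs → IsPart xs × sum xs ≡ n) (partitions n)
partitions-enum n = Enum-⇔ (λ (d , s) → (n , d) , s)
  (λ { {xs} ((_ , d) , refl) → Desc-sum xs d , refl }) (partsLE-enum n n n ≤-refl)

IsBipart : ℕ → List ℕ × List ℕ → Set
IsBipart n (xs , ys) = IsPart xs × IsPart ys × sum xs + sum ys ≡ n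

bipartitions-enum : ∀ n → Enum (IsBipart n) (bipartitions n)
bipartitions-enum n = Enum-⇔ fwd bwd
  (Enum-concatMap {P = Fiber} (Uniq.upTo⁺ (suc n))
    (λ {k} _ → Enum-cartesian (partitions-enum k) (partitions-enum (n ∸ k)))
    (λ ((_ , s) , _) ((_ , s′) , _) → trans (sym s) s′))
  where
  Fiber : ℕ → List ℕ × List ℕ → Set
  Fiber k (xs , ys) = (IsPart xs × sum xs ≡ k) × (IsPart ys × sum ys ≡ n ∸ k)
  fwd : ∀ {b} → (∃[ k ] k ∈ upTo (suc n) × Fiber k b) → IsBipart n b
  fwd {xs , ys} (k , k∈ , (p , refl) , (q , s)) =
    p , q , trans (cong (sum xs +_) s) (m+[n∸m]≡n (≤-pred (∈-upTo⁻ k∈)))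
  bwd : ∀ {b} → IsBipart n b → ∃[ k ] k ∈ upTo (suc n) × Fiber k b
  bwd {xs , ys} (p , q , refl) =
    sum xs , ∈-upTo⁺ (s≤s (m≤m+n _ _)) , (p , refl) , (q , sym (m+n∸m≡n (sum xs) (sum ys)))

-- Sorted insertion; splitting a partition into odd and even parts.

insert : ℕ → List ℕ → List ℕ
insert y []       = y ∷ []
insert y (x ∷ xs) with y <? x
... | yes _ = x ∷ insert y xs
... | no  _ = y ∷ x ∷ xs

insert-< : ∀ {x y xs} → y < x → insert y (x ∷ xs) ≡ x ∷ insert y xs
insert-< {x} {y} y<x with y <? x
... | yes _   = refl
... | no  y≮x = contradiction y<x y≮x

insert-≥ : ∀ {y} xs → Desc y xs → insert y xs ≡ y ∷ xs
insert-≥ []       d = refl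
insert-≥ {y} (x ∷ xs) (_ , x≤y , _) with y <? x
... | yes y<x = contradiction x≤y (<⇒≱ y<x)
... | no  _   = refl

insert-Desc : ∀ {b y} xs → 1 ≤ y → y ≤ b → Desc b xs → Desc b (insert y xs)
insert-Desc [] 1≤y y≤b d = 1≤y , y≤b , tt
insert-Desc {y = y} (x ∷ xs) 1≤y y≤b (1≤x , x≤b , d) with y <? x
... | yes y<x = 1≤x , x≤b , insert-Desc xs 1≤y (<⇒≤ y<x) d
... | no  y≮x = 1≤y , y≤b , 1≤x , ≮⇒≥ y≮x , d

insert-IsPart : ∀ {y} xs → 1 ≤ y → IsPart xs → IsPart (insert y xs)
insert-IsPart {y} xs 1≤y (b , d) =
  b ⊔ y , insert-Desc xs 1≤y (m≤n⊔m b y) (Desc-weaken xs (m≤m⊔n b y) d)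

data Parity : ℕ → Set where
  even : ∀ h → Parity (h * 2)
  odd  : ∀ h → Parity (suc (h * 2))

parity : ∀ x → Parity x
parity zero = even 0
parity (suc x) with parity x
... | even h = odd h
... | odd h  = even (suc h)

odd?-odd : ∀ h → odd? (suc (h * 2)) ≡ true
odd?-odd h = cong (_≡ᵇ 1) ([m+kn]%n≡m%n 1 h 2)

odd?-even : ∀ h → odd? (h * 2) ≡ false
odd?-even h = cong (_≡ᵇ 1) (m*n%n≡0 h 2)

rows : List ℕ → List ℕ
rows xs = ells 1 2 (oddParts xs)

evenParts : List ℕ → List ℕ
evenParts = filter (λ x → T? (not (odd? x)))

halves : List ℕ → List ℕ
halves xs = map (_/ 2) (evenParts xs)

rows-odd : ∀ h xs → rows (suc (h * 2) ∷ xs) ≡ suc h ∷ rows xs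
rows-odd h xs = trans
  (cong (ells 1 2) (filter-accept (T? ∘ odd?) {x = suc (h * 2)} {xs} (subst T (sym (odd?-odd h)) tt)))
  (cong (λ k → suc k ∷ rows xs) (m*n/n≡m h 2))

rows-even : ∀ h xs → rows (h * 2 ∷ xs) ≡ rows xs
rows-even h xs = cong (ells 1 2) (filter-reject (T? ∘ odd?) {x = h * 2} {xs} (subst T (odd?-even h)))

halves-odd : ∀ h xs → halves (suc (h * 2) ∷ xs) ≡ halves xs
halves-odd h xs = cong (map (_/ 2))
  (filter-reject (T? ∘ not ∘ odd?) {x = suc (h * 2)} {xs} (subst (T ∘ not) (odd?-odd h)))

halves-even : ∀ h xs → halves (h * 2 ∷ xs) ≡ h ∷ halves xs
halves-even h xs = trans
  (cong (map (_/ 2)) (filter-accept (T? ∘ not ∘ odd?) {x = h * 2} {xs}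
    (subst (T ∘ not) (sym (odd?-even h)) tt)))
  (cong (_∷ halves xs) (m*n/n≡m h 2))

-- The odd part whose row in the 2-modular diagram has l ≥ 1 boxes.
oddPart : ℕ → ℕ
oddPart l = pred (l * 2)

W : List ℕ → ℕ
W ls = sum (map oddPart ls)

-- For non-increasing `ls`, `foldr` inserts the shortest row first, so each new odd part is at least
-- as large as the odd parts already present, as `rows-insert` requires.
join : List ℕ → List ℕ → List ℕ
join ls es = foldr (insert ∘ oddPart) (map (_* 2) es) ls

-- Insertion moves past strictly larger parts only. An odd one among them would have a row longer
-- than `l`, so they are all even and the new row comes first.
rows-insert : ∀ {l} ys → 1 ≤ l → Desc l (rows ys) → rows (insert (oddPart l) ys) ≡ l ∷ rows ys
rows-insert {suc l} [] 1≤l d = rows-odd l []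
rows-insert {suc l} (y ∷ ys) 1≤l d with suc (l * 2) <? y
... | no _ = rows-odd l (y ∷ ys)
... | yes l<y with parity y
...   | odd h = ⊥-elim (<-irrefl refl (<-≤-trans l<y (s≤s (*-monoˡ-≤ 2 (≤-pred (proj₁ (proj₂ d′)))))))
        where d′ = subst (Desc (suc l)) (rows-odd h ys) d
...   | even h = begin
        rows (h * 2 ∷ insert (suc (l * 2)) ys) ≡⟨ rows-even h (insert (suc (l * 2)) ys) ⟩
        rows (insert (suc (l * 2)) ys)         ≡⟨ rows-insert ys 1≤l (subst (Desc (suc l)) (rows-even h ys) d) ⟩
        suc l ∷ rows ys                        ≡⟨ cong (suc l ∷_) (rows-even h ys) ⟨
        suc l ∷ rows (h * 2 ∷ ys)              ∎
        where open ≡-Reasoning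

halves-∷-cong : ∀ x {xs ys} → halves xs ≡ halves ys → halves (x ∷ xs) ≡ halves (x ∷ ys)
halves-∷-cong x {xs} {ys} eq with parity x
... | odd h  = trans (halves-odd h xs) (trans eq (sym (halves-odd h ys)))
... | even h = trans (halves-even h xs) (trans (cong (h ∷_) eq) (sym (halves-even h ys)))

halves-insert : ∀ {l} ys → 1 ≤ l → halves (insert (oddPart l) ys) ≡ halves ys
halves-insert {suc l} [] 1≤l = halves-odd l []
halves-insert {suc l} (y ∷ ys) 1≤l with suc (l * 2) <? y
... | no _  = halves-odd l (y ∷ ys)
... | yes _ = halves-∷-cong y (halves-insert ys 1≤l)

rows-join : ∀ {b} ls es → Desc b ls → rows (join ls es) ≡ ls
rows-join [] [] d = refl
rows-join [] (e ∷ es) d = trans (rows-even e (map (_* 2) es)) (rows-join {0} [] es tt)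
rows-join (l ∷ ls) es (1≤l , _ , d) =
  trans (rows-insert (join ls es) 1≤l (subst (Desc l) (sym ih) d)) (cong (l ∷_) ih)
  where ih = rows-join ls es d

halves-join : ∀ {b} ls es → Desc b ls → halves (join ls es) ≡ es
halves-join [] [] d = refl
halves-join [] (e ∷ es) d = trans (halves-even e (map (_* 2) es)) (cong (e ∷_) (halves-join {0} [] es tt))
halves-join (l ∷ ls) es (1≤l , _ , d) = trans (halves-insert (join ls es) 1≤l) (halves-join ls es d)

join-∷ : ∀ {x ls zs} → All (λ l → oddPart l < x) ls →
         foldr (insert ∘ oddPart) (x ∷ zs) ls ≡ x ∷ foldr (insert ∘ oddPart) zs ls
join-∷ [] = refl
join-∷ {ls = l ∷ _} (l<x ∷ a) = trans (cong (insert (oddPart l)) (join-∷ a)) (insert-< l<x)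

-- An odd part that is at most 2h is strictly below 2h. The strictness lets `join-∷` keep an even
-- leading part in front of the odd parts inserted later.
rows-bound : ∀ {b} h xs → b ≤ h * 2 → Desc b xs → All (λ l → oddPart l < h * 2) (rows xs)
rows-bound h [] b≤ d = []
rows-bound h (x ∷ xs) b≤ (1≤x , x≤b , d) with parity x
... | even k = subst (All _) (sym (rows-even k xs)) (rows-bound h xs (≤-trans x≤b b≤) d)
... | odd k  = subst (All _) (sym (rows-odd k xs)) (bound ∷ rows-bound h xs x≤2h d)
  where
  x≤2h = ≤-trans x≤b b≤
  bound : suc (k * 2) < h * 2
  bound = *-monoˡ-≤ 2 (*-cancelʳ-< 2 k h x≤2h)

join-rows-halves : ∀ {b} xs → Desc b xs → join (rows xs) (halves xs) ≡ xs
join-rows-halves [] d = refl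
join-rows-halves (x ∷ xs) (1≤x , _ , d) with parity x
... | odd h = begin
  join (rows (x′ ∷ xs)) (halves (x′ ∷ xs)) ≡⟨ cong₂ join (rows-odd h xs) (halves-odd h xs) ⟩
  insert x′ (join (rows xs) (halves xs))   ≡⟨ cong (insert x′) (join-rows-halves xs d) ⟩
  insert x′ xs                             ≡⟨ insert-≥ xs d ⟩
  x′ ∷ xs                                  ∎
  where
  open ≡-Reasoning
  x′ = suc (h * 2)
... | even h = begin
  join (rows (h * 2 ∷ xs)) (halves (h * 2 ∷ xs)) ≡⟨ cong₂ join (rows-even h xs) (halves-even h xs) ⟩
  join (rows xs) (h ∷ halves xs)                 ≡⟨ join-∷ (rows-bound h xs ≤-refl d) ⟩
  h * 2 ∷ join (rows xs) (halves xs)             ≡⟨ cong (h * 2 ∷_) (join-rows-halves xs d) ⟩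
  h * 2 ∷ xs                                     ∎
  where open ≡-Reasoning

rows-Desc : ∀ {b c} xs → b ≤ c * 2 → Desc b xs → Desc c (rows xs)
rows-Desc [] b≤ d = tt
rows-Desc {c = c} (x ∷ xs) b≤ (1≤x , x≤b , d) with parity x
... | even h = subst (Desc c) (sym (rows-even h xs)) (rows-Desc xs (≤-trans x≤b b≤) d)
... | odd h  = subst (Desc c) (sym (rows-odd h xs))
                 (s≤s z≤n , *-cancelʳ-< 2 h c (≤-trans x≤b b≤) , rows-Desc xs (n≤1+n _) d)

halves-Desc : ∀ {b c} xs → b ≤ suc (c * 2) → Desc b xs → Desc c (halves xs)
halves-Desc [] b≤ d = tt
halves-Desc {c = c} (x ∷ xs) b≤ (1≤x , x≤b , d) with parity x
... | odd h  = subst (Desc c) (sym (halves-odd h xs)) (halves-Desc xs (≤-trans x≤b b≤) d)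
... | even h = subst (Desc c) (sym (halves-even h xs))
                 ( *-cancelʳ-< 2 0 h 1≤x
                 , ≤-pred (*-cancelʳ-< 2 h (suc c) (s≤s (≤-trans x≤b b≤)))
                 , halves-Desc xs (n≤1+n _) d )

double-Desc : ∀ {b} es → Desc b es → Desc (b * 2) (map (_* 2) es)
double-Desc [] d = tt
double-Desc (e ∷ es) (1≤e , e≤b , d) =
  ≤-trans 1≤e (m≤m*n e 2) , *-monoˡ-≤ 2 e≤b , double-Desc es d

join-IsPart : ∀ {b} ls es → Desc b ls → IsPart es → IsPart (join ls es)
join-IsPart [] es d (c , d′) = c * 2 , double-Desc es d′
join-IsPart (suc l ∷ ls) es (_ , _ , d) p =
  insert-IsPart (join ls es) (s≤s z≤n) (join-IsPart ls es d p)

sum-rows-halves : ∀ xs → sum xs ≡ W (rows xs) + sum (halves xs) * 2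
sum-rows-halves [] = refl
sum-rows-halves (x ∷ xs) with parity x
... | odd h rewrite rows-odd h xs | halves-odd h xs | sum-rows-halves xs =
  sym (+-assoc (suc (h * 2)) (W (rows xs)) (sum (halves xs) * 2))
... | even h rewrite rows-even h xs | halves-even h xs | sum-rows-halves xs =
  arith h (W (rows xs)) (sum (halves xs))
  where
  arith : ∀ h w s → h * 2 + (w + s * 2) ≡ w + (h + s) * 2
  arith = solve-∀

Triple : Set
Triple = List ℕ × List ℕ × List ℕ

-- (a , l , e) encodes the bipartition (π₁ , π₂) with π₁ = a, the odd parts of π₂ having rows l, and the
-- even parts of π₂ being the doubles of e.
IsTriple : ℕ → Triple → Set
IsTriple n (a , l , e) = IsPart a × IsPart l × IsPart e × sum a + (W l + sum e * 2) ≡ n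

split : List ℕ × List ℕ → Triple
split (xs , ys) = xs , rows ys , halves ys

unsplit : Triple → List ℕ × List ℕ
unsplit (a , l , e) = a , join l e

split-≅ : ∀ n → IsBipart n ≅ IsTriple n
split-≅ n = record
  { to = split ; from = unsplit
  ; to-ok = λ { {xs , ys} (p , (b , d) , s) →
      p , (b , rows-Desc ys (m≤m*n b 2) d) , (b , halves-Desc ys (≤-trans (m≤m*n b 2) (n≤1+n _)) d)
      , trans (cong (sum xs +_) (sym (sum-rows-halves ys))) s }
  ; from-ok = λ { {a , l , e} (p , (b , d) , q , s) → p , join-IsPart l e d q ,
      trans (cong (sum a +_) (trans (sum-rows-halves (join l e))
        (cong₂ (λ l e → W l + sum e * 2) (rows-join l e d) (halves-join l e d)))) s }
  ; from-to = λ { {xs , ys} (_ , (_ , d) , _) → cong (xs ,_) (join-rows-halves ys d) }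
  ; to-from = λ { {a , l , e} (_ , (_ , d) , _) →
      cong₂ (λ l e → a , l , e) (rows-join l e d) (halves-join l e d) } }

-- Rows that end on a shifted diagonal.

-- Fix r (l₀ ∷ l₁ ∷ …) says that lᵢ = r + i for some i.  The lists are meant to be non-increasing: lᵢ − i
-- then decreases strictly, so that the search ends at the first lᵢ ≤ r + i.
data Fix : ℕ → List ℕ → Set where
  hit  : ∀ {r ls} → Fix r (r ∷ ls)
  step : ∀ {r l ls} → r < l → Fix (suc r) ls → Fix r (l ∷ ls)

data NoFix : ℕ → List ℕ → Set where
  nil  : ∀ {r} → NoFix r []
  stop : ∀ {r l ls} → l < r → NoFix r (l ∷ ls)
  step : ∀ {r l ls} → r < l → NoFix (suc r) ls → NoFix r (l ∷ ls)

fix? : ∀ r ls → Fix r ls ⊎ NoFix r ls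
fix? r [] = inj₂ nil
fix? r (l ∷ ls) with <-cmp r l
... | tri≈ _ refl _ = inj₁ hit
... | tri> _ _ l<r  = inj₂ (stop l<r)
... | tri< r<l _ _ with fix? (suc r) ls
...   | inj₁ f = inj₁ (step r<l f)
...   | inj₂ f = inj₂ (step r<l f)

Fix⇒¬NoFix : ∀ {r ls} → Fix r ls → ¬ NoFix r ls
Fix⇒¬NoFix hit          (stop r<r)   = <-irrefl refl r<r
Fix⇒¬NoFix hit          (step r<r _) = <-irrefl refl r<r
Fix⇒¬NoFix (step r<l f) (stop l<r)   = <-asym r<l l<r
Fix⇒¬NoFix (step _ f)   (step _ g)   = Fix⇒¬NoFix f g

-- The conditions of `M` in terms of rows.

Has : ℕ → List ℕ → Set
Has μ l = ∀ {j} → j < μ → suc j ∈ l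

-- The length of the initial run of rows with lᵢ > r + i, counted from i = 0. For r = ν + 2 this is
-- the height of the Durfee rectangle, found from the top, whereas `durf` looks for the last
-- suitable index.
height : ℕ → List ℕ → ℕ
height r []       = 0
height r (l ∷ ls) = if r <ᵇ l then suc (height (suc r) ls) else 0

height-zero : ∀ {b r} ls → b ≤ r → Desc b ls → height r ls ≡ 0
height-zero [] b≤r d = refl
height-zero {r = r} (l ∷ ls) b≤r (_ , l≤b , _) with r <ᵇ l in eq
... | false = refl
... | true  = contradiction (≤-trans l≤b b≤r) (<⇒≱ (<ᵇ⇒< r l (subst T (sym eq) tt)))

-- As durf, this returns 0 when there is no index at all.
lastIndex : ℕ → ℕ → ℕ
lastIndex i zero    = 0
lastIndex i (suc c) = i + suc c

-- The first failing index and the last passing one are adjacent: once a row is too short, the rows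
-- below it, being no longer, fail too (`height-zero`).
durf-height : ∀ {b} ν i ls → Desc b ls → durf ν (suc i) ls ≡ lastIndex i (height (i + ν + 2) ls)
durf-height ν i [] d = refl
durf-height ν i (l ∷ ls) (_ , _ , d) with durf ν (suc (suc i)) ls | durf-height ν (suc i) ls d
durf-height ν i (l ∷ ls) (_ , _ , d) | zero | ih with (i + ν + 2) <ᵇ l
... | false = refl
... | true with height (suc (i + ν + 2)) ls
...   | zero = +-comm 1 i
...   | suc c with () ← ih
durf-height ν i (l ∷ ls) (_ , _ , d) | suc _ | ih with (i + ν + 2) <ᵇ l in eq
-- Here a later row would pass although this one fails. The rewriting turns `ih` into the absurd
-- equation `suc _ ≡ 0`, which is also the goal.
... | false rewrite height-zero ls (≤-trans (≮⇒≥ (λ lt → subst T eq (<⇒<ᵇ lt))) (n≤1+n (i + ν + 2))) d = ih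
... | true with height (suc (i + ν + 2)) ls
...   | suc c = trans ih (sym (+-suc i (suc c)))

-- The first row after the run has length at most `height r ls + r`, because the run stops there.
-- The hypothesis excludes equality, which is exactly what a row on the diagonal would need.
below-height⇒NoFix : ∀ {b} r ls → Desc b ls → All (_< height r ls + r) (drop (height r ls) ls) → NoFix r ls
below-height⇒NoFix r [] d a = nil
below-height⇒NoFix r (l ∷ ls) (_ , _ , d) a with r <ᵇ l in eq
below-height⇒NoFix r (l ∷ ls) (_ , _ , d) a | true =
  step (<ᵇ⇒< r l (subst T (sym eq) tt))
    (below-height⇒NoFix (suc r) ls d (subst (λ k → All (_< k) (drop (height (suc r) ls) ls)) (sym (+-suc _ r)) a))
below-height⇒NoFix r (l ∷ ls) (_ , _ , d) (l<r ∷ _) | false = stop l<r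

Desc⇒All≤ : ∀ {b c} ls → b ≤ c → Desc b ls → All (_≤ c) ls
Desc⇒All≤ [] b≤c d = []
Desc⇒All≤ (l ∷ ls) b≤c (_ , l≤b , d) = ≤-trans l≤b b≤c ∷ Desc⇒All≤ ls (≤-trans l≤b b≤c) d

NoFix⇒below-height : ∀ {b} r ls → Desc b ls → NoFix r ls → All (_< height r ls + r) (drop (height r ls) ls)
NoFix⇒below-height r [] d f = []
NoFix⇒below-height r (l ∷ ls) (_ , _ , d) f with r <ᵇ l in eq
NoFix⇒below-height r (l ∷ ls) (_ , _ , d) (step _ f) | true =
  subst (λ k → All (_< k) (drop (height (suc r) ls) ls)) (+-suc _ r) (NoFix⇒below-height (suc r) ls d f)
NoFix⇒below-height r (l ∷ ls) (_ , _ , d) (stop l<r) | true =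
  contradiction (<ᵇ⇒< r l (subst T (sym eq) tt)) (<-asym l<r)
NoFix⇒below-height r (l ∷ ls) (_ , _ , d) (step r<l _) | false = ⊥-elim (subst T eq (<⇒<ᵇ r<l))
NoFix⇒below-height r (l ∷ ls) (_ , _ , d) (stop l<r) | false =
  -- The row that ends the run is already short enough, and the later rows are no longer than it.
  l<r ∷ All.map (λ x≤l → ≤-<-trans x≤l l<r) (Desc⇒All≤ ls ≤-refl d)

durfeeHeight-height : ∀ {b} ν ls → Desc b ls → durfeeHeight ν ls ≡ height (ν + 2) ls
durfeeHeight-height ν ls d = trans (durf-height ν 0 ls d) (eq (height (ν + 2) ls))
  where
  eq : ∀ c → lastIndex 0 c ≡ c
  eq zero    = refl
  eq (suc c) = refl

∈-rows⁺ : ∀ j os → suc (2 * j) ∈ os → suc j ∈ ells 1 2 os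
∈-rows⁺ j os x∈ = subst (_∈ ells 1 2 os) (cong suc (trans (cong (_/ 2) (*-comm 2 j)) (m*n/n≡m j 2)))
                    (∈-map⁺ (λ x → suc ((x ∸ 1) / 2)) x∈)

∈-rows⁻ : ∀ j os → All (T ∘ odd?) os → suc j ∈ ells 1 2 os → suc (2 * j) ∈ os
∈-rows⁻ j os o j∈ with ∈-map⁻ (λ x → suc ((x ∸ 1) / 2)) j∈
... | x , x∈ , eq with All.lookup o x∈ | parity x
...   | px | even h = ⊥-elim (subst T (odd?-even h) px)
...   | px | odd h  =
  subst (_∈ os) (cong suc (trans (*-comm h 2) (cong (2 *_) h≡j))) x∈
  where
  h≡j : h ≡ j
  h≡j = trans (sym (m*n/n≡m h 2)) (sym (suc-injective eq))

-- The part 2j + 1 has a row of j + 1 boxes, so the occurrence test becomes `Has`, and the Durfee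
-- test becomes `NoFix`. Since `NoFix` counts rows from 0, the condition ℓᵢ ≠ i + μ with i ≥ 1 and μ
-- = ν + 1 has offset μ + 1 = ν + 2.
M-ok⇒ : ∀ {b} ν ys → Desc b (rows ys) → T (M-ok 1 2 ν (oddParts ys)) →
        Has (suc ν) (rows ys) × NoFix (suc (suc ν)) (rows ys)
M-ok⇒ {b} ν ys d ok = has , subst (λ r → NoFix r ls) (+-comm ν 2) nofix
  where
  os = oddParts ys
  ls = rows ys
  t = durfeeHeight ν ls
  contains : ℕ → Bool
  contains j = any (λ x → x ≡ᵇ (1 + 2 * j)) os
  ok₂₃ = proj₂ (Equivalence.to (T-∧ {all odd? os}) ok)
  ok₂ = proj₁ (Equivalence.to (T-∧ {all contains (upTo (suc ν))}) ok₂₃)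
  ok₃ = proj₂ (Equivalence.to (T-∧ {all contains (upTo (suc ν))}) ok₂₃)
  has : Has (suc ν) ls
  has {j} j<ν = ∈-rows⁺ j os (Any.map (λ {x} eq → sym (≡ᵇ⇒≡ x _ eq))
    (any⁻ _ os (All.lookup (all⁺ contains (upTo (suc ν)) ok₂) (∈-upTo⁺ j<ν))))
  below : All (_< t + ν + 2) (drop t ls)
  below = All.map (λ {x} → <ᵇ⇒< x _) (all⁺ _ (drop t ls) ok₃)
  nofix : NoFix (ν + 2) ls
  nofix = below-height⇒NoFix (ν + 2) ls d
    (subst (λ t → All (_< t + (ν + 2)) (drop t ls)) (durfeeHeight-height ν ls d)
      (subst (λ k → All (_< k) (drop t ls)) (+-assoc t ν 2) below))

⇒M-ok : ∀ {b} ν ys → Desc b (rows ys) → Has (suc ν) (rows ys) → NoFix (suc (suc ν)) (rows ys) →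
        T (M-ok 1 2 ν (oddParts ys))
⇒M-ok ν ys d has nofix =
  Equivalence.from T-∧ (all⁻ _ odds , Equivalence.from T-∧ (all⁻ _ has′ , all⁻ _ (All.map <⇒<ᵇ below)))
  where
  os = oddParts ys
  ls = rows ys
  t = durfeeHeight ν ls
  odds : All (T ∘ odd?) os
  odds = all-filter (T? ∘ odd?) ys
  has′ : All (λ j → T (any (λ x → x ≡ᵇ (1 + 2 * j)) os)) (upTo (suc ν))
  has′ = All.tabulate (λ {j} j∈ →
    any⁺ _ (Any.map (λ {x} eq → ≡⇒≡ᵇ x _ (sym eq)) (∈-rows⁻ j os odds (has (∈-upTo⁻ j∈)))))
  below : All (_< t + ν + 2) (drop t ls)
  below = subst (λ k → All (_< k) (drop t ls)) (sym (+-assoc t ν 2))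
    (subst (λ t → All (_< t + (ν + 2)) (drop t ls)) (sym (durfeeHeight-height ν ls d))
      (NoFix⇒below-height (ν + 2) ls d (subst (λ r → NoFix r ls) (+-comm 2 ν) nofix)))

-- Removing a row; adding a row of length `suc μ`.

remove : ℕ → List ℕ → List ℕ
remove y []       = []
remove y (x ∷ xs) with x ≟ y
... | yes _ = xs
... | no  _ = x ∷ remove y xs

remove-insert : ∀ y xs → remove y (insert y xs) ≡ xs
remove-insert y [] with y ≟ y
... | yes _ = refl
... | no ¬p = contradiction refl ¬p
remove-insert y (x ∷ xs) with y <? x
... | no _ with y ≟ y
...   | yes _ = refl
...   | no ¬p = contradiction refl ¬p
remove-insert y (x ∷ xs) | yes y<x with x ≟ y
...   | yes refl = contradiction y<x (<-irrefl refl)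
...   | no _     = cong (x ∷_) (remove-insert y xs)

∈⇒≤ : ∀ {b y} xs → Desc b xs → y ∈ xs → y ≤ b
∈⇒≤ (x ∷ xs) (_ , x≤b , _) (here refl) = x≤b
∈⇒≤ (x ∷ xs) (_ , x≤b , d) (there y∈)  = ≤-trans (∈⇒≤ xs d y∈) x≤b

insert-remove : ∀ {b} y xs → Desc b xs → y ∈ xs → insert y (remove y xs) ≡ xs
insert-remove y (x ∷ xs) (_ , _ , d) y∈ with x ≟ y
... | yes refl = insert-≥ xs d
insert-remove y (x ∷ xs) (_ , _ , d) (here refl) | no x≢y = contradiction refl x≢y
insert-remove y (x ∷ xs) (_ , _ , d) (there y∈)  | no x≢y =
  trans (insert-< (≤∧≢⇒< (∈⇒≤ xs d y∈) (x≢y ∘ sym))) (cong (x ∷_) (insert-remove y xs d y∈))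

remove-Desc : ∀ {b} y xs → Desc b xs → Desc b (remove y xs)
remove-Desc y [] d = tt
remove-Desc y (x ∷ xs) (1≤x , x≤b , d) with x ≟ y
... | yes _ = Desc-weaken xs x≤b d
... | no  _ = 1≤x , x≤b , remove-Desc y xs d

∈-insert : ∀ y xs → y ∈ insert y xs
∈-insert y [] = here refl
∈-insert y (x ∷ xs) with y <? x
... | yes _ = there (∈-insert y xs)
... | no  _ = here refl

∈-insert⁺ : ∀ y {z} xs → z ∈ xs → z ∈ insert y xs
∈-insert⁺ y (x ∷ xs) z∈ with y <? x
∈-insert⁺ y (x ∷ xs) (here refl) | yes _ = here refl
∈-insert⁺ y (x ∷ xs) (there z∈)  | yes _ = there (∈-insert⁺ y xs z∈)
... | no _ = there z∈

∈-remove⁺ : ∀ y {z} xs → z ≢ y → z ∈ xs → z ∈ remove y xs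
∈-remove⁺ y (x ∷ xs) z≢y z∈ with x ≟ y
∈-remove⁺ y (x ∷ xs) z≢y (here refl) | yes x≡y = contradiction x≡y z≢y
∈-remove⁺ y (x ∷ xs) z≢y (there z∈)  | yes x≡y = z∈
∈-remove⁺ y (x ∷ xs) z≢y (here refl) | no _ = here refl
∈-remove⁺ y (x ∷ xs) z≢y (there z∈)  | no _ = there (∈-remove⁺ y xs z≢y z∈)

W-insert : ∀ y xs → W (insert y xs) ≡ oddPart y + W xs
W-insert y [] = refl
W-insert y (x ∷ xs) with y <? x
... | no _  = refl
... | yes _ = trans (cong (oddPart x +_) (W-insert y xs)) (arith (oddPart x) (oddPart y) (W xs))
  where
  arith : ∀ a b c → a + (b + c) ≡ b + (a + c)
  arith = solve-∀

HasTriple : ℕ → ℕ → Triple → Set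
HasTriple μ n t@(a , l , e) = IsTriple n t × Has μ l

-- The new row weighs 2μ + 1, the difference of the squares of μ + 1 and μ; hence the total shift μ²
-- in `card-Has`.
insert-≅ : ∀ μ n → HasTriple μ n ≅ HasTriple (suc μ) (oddPart (suc μ) + n)
insert-≅ μ n = record
  { to = λ (a , l , e) → a , insert (suc μ) l , e
  ; from = λ (a , l , e) → a , remove (suc μ) l , e
  ; to-ok = λ { {a , l , e} ((pa , pl , pe , s) , has) →
      (pa , insert-IsPart l (s≤s z≤n) pl , pe , trans (weight a l e) (cong (oddPart (suc μ) +_) s)) , has⁺ l has }
  ; from-ok = λ { {a , l , e} ((pa , (b , d) , pe , s) , has) →
      (pa , (b , remove-Desc (suc μ) l d) , pe ,
       +-cancelˡ-≡ (oddPart (suc μ)) _ _ (trans (sym (weight a (remove (suc μ) l) e))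
         (trans (cong (λ l → sum a + (W l + sum e * 2)) (insert-remove (suc μ) l d (has ≤-refl))) s)))
      , λ j<μ → ∈-remove⁺ (suc μ) l (<⇒≢ (s≤s j<μ)) (has (m≤n⇒m≤1+n j<μ)) }
  ; from-to = λ { {a , l , e} _ → cong (λ l → a , l , e) (remove-insert (suc μ) l) }
  ; to-from = λ { {a , l , e} ((_ , (_ , d) , _) , has) →
      cong (λ l → a , l , e) (insert-remove (suc μ) l d (has ≤-refl)) } }
  where
  arith : ∀ a o w e → a + (o + w + e * 2) ≡ o + (a + (w + e * 2))
  arith = solve-∀
  weight : ∀ a l e → sum a + (W (insert (suc μ) l) + sum e * 2) ≡ oddPart (suc μ) + (sum a + (W l + sum e * 2))
  weight a l e = trans (cong (λ w → sum a + (w + sum e * 2)) (W-insert (suc μ) l))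
                       (arith (sum a) (oddPart (suc μ)) (W l) (sum e))
  has⁺ : ∀ l → Has μ l → Has (suc μ) (insert (suc μ) l)
  has⁺ l has {j} j≤μ with j ≟ μ
  ... | yes refl = ∈-insert (suc μ) l
  ... | no j≢μ   = ∈-insert⁺ (suc μ) l (has (≤∧≢⇒< (≤-pred j≤μ) j≢μ))

-- Trading a row on the diagonal for a row of length `suc μ`.

promote : ℕ → ℕ → List ℕ → List ℕ
promote μ r []       = []
promote μ r (l ∷ ls) with r <? l
... | yes _ = suc l ∷ promote μ (suc r) ls
... | no  _ = insert (suc μ) ls

-- A row lengthened by `promote` exceeds `suc r` at its position, which identifies these rows. At
-- the first other row `NoFix (suc r)` also excludes length `suc r`, so the lost row of length `r`
-- fits in front of it.
demote : ℕ → ℕ → List ℕ → List ℕ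
demote μ r []       = []
demote μ r (l ∷ ls) with suc r <? l
... | yes _ = pred l ∷ demote μ (suc r) ls
... | no  _ = r ∷ remove (suc μ) (l ∷ ls)

promote-step : ∀ {μ r l ls} → r < l → promote μ r (l ∷ ls) ≡ suc l ∷ promote μ (suc r) ls
promote-step {r = r} {l} r<l with r <? l
... | yes _ = refl
... | no ¬p = contradiction r<l ¬p

promote-hit : ∀ {μ r ls} → promote μ r (r ∷ ls) ≡ insert (suc μ) ls
promote-hit {r = r} with r <? r
... | yes p = contradiction p (<-irrefl refl)
... | no _  = refl

demote-step : ∀ {μ r l ls} → suc r < l → demote μ r (l ∷ ls) ≡ pred l ∷ demote μ (suc r) ls
demote-step {r = r} {l} r<l with suc r <? l
... | yes _ = refl
... | no ¬p = contradiction r<l ¬p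

demote-stop : ∀ {μ r ls} → Desc r ls → suc μ ∈ ls → demote μ r ls ≡ r ∷ remove (suc μ) ls
demote-stop {r = r} {l ∷ ls} (_ , l≤r , _) _ with suc r <? l
... | yes p = contradiction l≤r (<⇒≱ (<-trans (n<1+n r) p))
... | no _  = refl

Desc⇒NoFix : ∀ {r} ls → Desc r ls → NoFix (suc r) ls
Desc⇒NoFix []       d             = nil
Desc⇒NoFix (l ∷ ls) (_ , l≤r , _) = stop (s≤s l≤r)

tail-∈ : ∀ {r z l ls} → z < r → r < l → z ∈ l ∷ ls → z ∈ ls
tail-∈ z<r r<l (here refl) = contradiction z<r (<-asym r<l)
tail-∈ z<r r<l (there z∈)  = z∈

module _ {μ : ℕ} where

  promote-Desc : ∀ {b r ls} → μ < r → Fix r ls → Desc b ls → Desc (suc b) (promote μ r ls)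
  promote-Desc {b} {r} {_ ∷ ls} μ<r hit (1≤r , r≤b , d) rewrite promote-hit {μ} {r} {ls} =
    Desc-weaken (insert (suc μ) ls) (m≤n⇒m≤1+n r≤b) (insert-Desc ls (s≤s z≤n) μ<r d)
  promote-Desc {ls = l ∷ ls} μ<r (step r<l f) (1≤l , l≤b , d) rewrite promote-step {μ} {ls = ls} r<l =
    s≤s z≤n , s≤s l≤b , promote-Desc (m≤n⇒m≤1+n μ<r) f d

  -- The lengthened rows stay above the diagonal of offset `suc r`. Next comes the inserted row or
  -- the old successor of the deleted one; neither is longer than the deleted row, so it lies below
  -- that diagonal.
  promote-NoFix : ∀ {b r ls} → μ < r → Fix r ls → Desc b ls → NoFix (suc r) (promote μ r ls)
  promote-NoFix {r = r} {_ ∷ ls} μ<r hit (1≤r , r≤b , d) rewrite promote-hit {μ} {r} {ls} =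
    Desc⇒NoFix (insert (suc μ) ls) (insert-Desc ls (s≤s z≤n) μ<r d)
  promote-NoFix {ls = l ∷ ls} μ<r (step r<l f) (1≤l , l≤b , d) rewrite promote-step {μ} {ls = ls} r<l =
    step (s≤s r<l) (promote-NoFix (m≤n⇒m≤1+n μ<r) f d)

  promote-∈ : ∀ {r ls} → Fix r ls → suc μ ∈ promote μ r ls
  promote-∈ {r} {_ ∷ ls} hit rewrite promote-hit {μ} {r} {ls} = ∈-insert (suc μ) ls
  promote-∈ {ls = l ∷ ls} (step r<l f) rewrite promote-step {μ} {ls = ls} r<l = there (promote-∈ f)

  -- The rows up to and including the deleted one have length at least `r`, so a shorter row lies in
  -- the part that only receives an insertion.
  promote-∈⁺ : ∀ {r z ls} → z < r → Fix r ls → z ∈ ls → z ∈ promote μ r ls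
  promote-∈⁺ {r} {ls = _ ∷ ls} z<r hit (here refl) = contradiction z<r (<-irrefl refl)
  promote-∈⁺ {r} {ls = _ ∷ ls} z<r hit (there z∈) rewrite promote-hit {μ} {r} {ls} = ∈-insert⁺ (suc μ) ls z∈
  promote-∈⁺ z<r (step r<l f) (here refl) = contradiction z<r (<-asym r<l)
  promote-∈⁺ {ls = l ∷ ls} z<r (step r<l f) (there z∈) rewrite promote-step {μ} {ls = ls} r<l =
    there (promote-∈⁺ (m≤n⇒m≤1+n z<r) f z∈)

  -- If i rows precede the deleted one, its length is r + i. The deletion costs 2(r + i) - 1 and the
  -- lengthening gains 2i, a net loss of 2r - 1. For r = μ + 1 the inserted row makes up for this
  -- exactly.
  promote-W : ∀ {r ls} → μ < r → Fix r ls → W (promote μ r ls) + oddPart r ≡ W ls + oddPart (suc μ)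
  promote-W {r} {_ ∷ ls} μ<r hit rewrite promote-hit {μ} {r} {ls} | W-insert (suc μ) ls =
    arith (oddPart (suc μ)) (W ls) (oddPart r)
    where
    arith : ∀ a b c → a + b + c ≡ c + b + a
    arith = solve-∀
  promote-W {suc r} {suc l ∷ ls} μ<r (step r<l f) rewrite promote-step {μ} {ls = ls} r<l = begin
    oddPart (2 + l) + W′ + oddPart (suc r)     ≡⟨ arith₁ (l * 2) W′ (r * 2) ⟩
    oddPart (suc l) + (W′ + oddPart (2 + r))   ≡⟨ cong (oddPart (suc l) +_) (promote-W (m≤n⇒m≤1+n μ<r) f) ⟩
    oddPart (suc l) + (W ls + oddPart (suc μ)) ≡⟨ +-assoc (oddPart (suc l)) (W ls) _ ⟨
    oddPart (suc l) + W ls + oddPart (suc μ)   ∎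
    where
    open ≡-Reasoning
    W′ = W (promote μ (2 + r) ls)
    arith₁ : ∀ a b c → 3 + a + b + (1 + c) ≡ 1 + a + (b + (3 + c))
    arith₁ = solve-∀

  demote-promote : ∀ {b r ls} → μ < r → Fix r ls → Desc b ls → demote μ r (promote μ r ls) ≡ ls
  demote-promote {r = r} {_ ∷ ls} μ<r hit (1≤r , r≤b , d) rewrite promote-hit {μ} {r} {ls} =
    trans (demote-stop (insert-Desc ls (s≤s z≤n) μ<r d) (∈-insert (suc μ) ls))
      (cong (r ∷_) (remove-insert (suc μ) ls))
  demote-promote {ls = l ∷ ls} μ<r (step r<l f) (1≤l , l≤b , d) rewrite promote-step {μ} {ls = ls} r<l =
    trans (demote-step (s≤s r<l)) (cong (l ∷_) (demote-promote (m≤n⇒m≤1+n μ<r) f d))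

  demote-Fix : ∀ {b r ls} → μ < r → NoFix (suc r) ls → Desc b ls → suc μ ∈ ls → Fix r (demote μ r ls)
  demote-Fix {r = r} {l ∷ ls} μ<r (stop l≤r) (1≤l , _ , d) μ∈
    rewrite demote-stop {μ} {r} {l ∷ ls} (1≤l , ≤-pred l≤r , d) μ∈ = hit
  demote-Fix {ls = l ∷ ls} μ<r (step r<l f) (_ , _ , d) μ∈ rewrite demote-step {μ} {ls = ls} r<l =
    step (≤-pred (≤-trans r<l (suc-pred-≤ l))) (demote-Fix (m≤n⇒m≤1+n μ<r) f d (tail-∈ (s≤s μ<r) r<l μ∈))
    where
    suc-pred-≤ : ∀ l → l ≤ suc (pred l)
    suc-pred-≤ zero    = z≤n
    suc-pred-≤ (suc l) = ≤-refl

  demote-Desc : ∀ {b r ls} → μ < r → r < b → NoFix (suc r) ls → Desc b ls → suc μ ∈ ls →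
                Desc (pred b) (demote μ r ls)
  demote-Desc {r = r} {l ∷ ls} μ<r r<b (stop l≤r) (1≤l , _ , d) μ∈
    rewrite demote-stop {μ} {r} {l ∷ ls} (1≤l , ≤-pred l≤r , d) μ∈ =
    ≤-trans (s≤s z≤n) μ<r , pred-mono-≤ r<b , remove-Desc (suc μ) (l ∷ ls) (1≤l , ≤-pred l≤r , d)
  demote-Desc {ls = l ∷ ls} μ<r r<b (step r<l f) (_ , l≤b , d) μ∈ rewrite demote-step {μ} {ls = ls} r<l =
    ≤-trans (s≤s z≤n) (pred-mono-≤ r<l) , pred-mono-≤ l≤b ,
    demote-Desc (m≤n⇒m≤1+n μ<r) r<l f d (tail-∈ (s≤s μ<r) r<l μ∈)

  demote-∈⁺ : ∀ {b r z ls} → z < suc μ → μ < r → NoFix (suc r) ls → Desc b ls →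
              suc μ ∈ ls → z ∈ ls → z ∈ demote μ r ls
  demote-∈⁺ {r = r} {ls = l ∷ ls} z<μ μ<r (stop l≤r) (1≤l , _ , d) μ∈ z∈
    rewrite demote-stop {μ} {r} {l ∷ ls} (1≤l , ≤-pred l≤r , d) μ∈ =
    there (∈-remove⁺ (suc μ) (l ∷ ls) (<⇒≢ z<μ) z∈)
  demote-∈⁺ {ls = l ∷ ls} z<μ μ<r (step r<l f) (_ , l≤b , d) μ∈ z∈ rewrite demote-step {μ} {ls = ls} r<l =
    there (demote-∈⁺ z<μ (m≤n⇒m≤1+n μ<r) f d (tail-∈ (s≤s μ<r) r<l μ∈) (tail-∈ (<-trans z<μ (s≤s μ<r)) r<l z∈))

  promote-demote : ∀ {b r ls} → μ < r → NoFix (suc r) ls → Desc b ls → suc μ ∈ ls →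
                   promote μ r (demote μ r ls) ≡ ls
  promote-demote {r = r} {l ∷ ls} μ<r (stop l≤r) dl@(1≤l , _ , d) μ∈
    rewrite demote-stop {μ} {r} {l ∷ ls} (1≤l , ≤-pred l≤r , d) μ∈ =
    trans (promote-hit {μ} {r}) (insert-remove (suc μ) (l ∷ ls) dl μ∈)
  promote-demote {ls = suc l ∷ ls} μ<r (step r<l f) (_ , l≤b , d) μ∈ rewrite demote-step {μ} {ls = ls} r<l =
    trans (promote-step (≤-pred r<l))
      (cong (suc l ∷_) (promote-demote (m≤n⇒m≤1+n μ<r) f d (tail-∈ (s≤s μ<r) r<l μ∈)))

FixTriple NoFixTriple : ℕ → ℕ → Triple → Set
FixTriple   μ n t@(a , l , e) = HasTriple μ n t × Fix (suc μ) l
NoFixTriple μ n t@(a , l , e) = HasTriple μ n t × NoFix (suc μ) l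

promote-≅ : ∀ μ n → FixTriple μ n ≅ NoFixTriple (suc μ) n
promote-≅ μ n = record
  { to = λ (a , l , e) → a , up l , e
  ; from = λ (a , l , e) → a , dn l , e
  ; to-ok = λ { {a , l , e} (((pa , (b , d) , pe , s) , has) , f) →
      ((pa , (suc b , promote-Desc ≤-refl f d) , pe , trans (cong (λ w → sum a + (w + sum e * 2)) (up-W f)) s)
      , up-has l has f) , promote-NoFix ≤-refl f d }
  -- The bound is raised to at least μ + 2 when applying `demote-Desc`, which lowers it by one and
  -- must leave room for the restored row of length μ + 1.
  ; from-ok = λ { {a , l , e} (((pa , (b , d) , pe , s) , has) , f) →
      ((pa , (_ , demote-Desc ≤-refl (m≤n⊔m b _) f (Desc-weaken l (m≤m⊔n b (2 + μ)) d) (has ≤-refl)) , pe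
         , trans (cong (λ w → sum a + (w + sum e * 2))
             (trans (sym (up-W (demote-Fix ≤-refl f d (has ≤-refl))))
               (cong W (promote-demote ≤-refl f d (has ≤-refl))))) s)
      , λ j<μ → demote-∈⁺ (s≤s j<μ) ≤-refl f d (has ≤-refl) (has (m≤n⇒m≤1+n j<μ)))
      , demote-Fix ≤-refl f d (has ≤-refl) }
  ; from-to = λ { {a , l , e} (((_ , (_ , d) , _) , _) , f) → cong (λ l → a , l , e) (demote-promote ≤-refl f d) }
  ; to-from = λ { {a , l , e} (((_ , (_ , d) , _) , has) , f) →
      cong (λ l → a , l , e) (promote-demote ≤-refl f d (has ≤-refl)) } }
  where
  up dn : List ℕ → List ℕ
  up = promote μ (suc μ)
  dn = demote μ (suc μ)
  up-W : ∀ {l} → Fix (suc μ) l → W (up l) ≡ W l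
  up-W f = +-cancelʳ-≡ _ _ _ (promote-W ≤-refl f)
  up-has : ∀ l → Has μ l → Fix (suc μ) l → Has (suc μ) (up l)
  up-has l has f {j} j≤μ with j ≟ μ
  ... | yes refl = promote-∈ f
  ... | no j≢μ   = promote-∈⁺ (s≤s j<μ) f (has j<μ)
    where j<μ = ≤∧≢⇒< (≤-pred j≤μ) j≢μ

-- Sylvester's bijection.

Strict : ℕ → List ℕ → Set
Strict b []       = ⊤
Strict b (x ∷ xs) = 1 ≤ x × x < b × Strict x xs

-- Deletes the first column of the diagram with the given rows.
down : List ℕ → List ℕ
down (suc (suc l) ∷ ls) = suc l ∷ down ls
down _                  = []

-- Prepends a first column with c more boxes than there are rows.
up : ℕ → List ℕ → List ℕ
up c rs = map suc rs ++ replicate c 1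

down-Desc : ∀ {b} ls → Desc (suc b) ls → Desc b (down ls)
down-Desc []                 d           = tt
down-Desc (suc zero ∷ ls)    d           = tt
down-Desc (suc (suc l) ∷ ls) (_ , s≤s l≤b , d) = s≤s z≤n , l≤b , down-Desc ls d

length-down : ∀ ls → length (down ls) ≤ length ls
length-down []                 = z≤n
length-down (zero ∷ ls)        = z≤n
length-down (suc zero ∷ ls)    = z≤n
length-down (suc (suc l) ∷ ls) = s≤s (length-down ls)

replicate-ones : ∀ ls → Desc 1 ls → replicate (length ls) 1 ≡ ls
replicate-ones []       d                       = refl
replicate-ones (l ∷ ls) (1≤l , l≤1 , d) with refl ← ≤-antisym 1≤l l≤1 = cong (1 ∷_) (replicate-ones ls d)

ones-Desc : ∀ {b} c → 1 ≤ b → Desc b (replicate c 1)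
ones-Desc zero    1≤b = tt
ones-Desc (suc c) 1≤b = ≤-refl , 1≤b , ones-Desc c ≤-refl

W-ones : ∀ c → W (replicate c 1) ≡ c
W-ones zero    = refl
W-ones (suc c) = cong suc (W-ones c)

up-down : ∀ {b} ls → Desc b ls → up (length ls ∸ length (down ls)) (down ls) ≡ ls
up-down []                 d           = refl
up-down (suc zero ∷ ls)    (_ , _ , d) = cong (1 ∷_) (replicate-ones ls d)
up-down (suc (suc l) ∷ ls) (_ , _ , d) = cong (suc (suc l) ∷_) (up-down ls d)

down-up : ∀ {b} c rs → Desc b rs → down (up c rs) ≡ rs
down-up zero    []           d           = refl
down-up (suc c) []           d           = refl
down-up c       (suc r ∷ rs) (_ , _ , d) = cong (suc r ∷_) (down-up c rs d)

up-Desc : ∀ {b} c rs → Desc b rs → Desc (suc b) (up c rs)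
up-Desc c []       d             = ones-Desc c (s≤s z≤n)
up-Desc c (r ∷ rs) (_ , r≤b , d) = s≤s z≤n , s≤s r≤b , up-Desc c rs d

length-up : ∀ c rs → length (up c rs) ≡ length rs + c
length-up c rs = trans (length-++ (map suc rs)) (cong₂ _+_ (length-map suc rs) (length-replicate c))

W-up : ∀ {b} c rs → Desc b rs → W (up c rs) ≡ W rs + length rs * 2 + c
W-up c []           d           = W-ones c
W-up c (suc r ∷ rs) (_ , _ , d) rewrite W-up c rs d = arith (r * 2) (W rs) (length rs) c
  where
  arith : ∀ r w k c → 3 + r + (w + k * 2 + c) ≡ 1 + r + w + (2 + k * 2) + c
  arith = solve-∀

-- Sylvester's bijection from odd parts (given by their rows) to distinct parts; the first argument
-- is fuel, for which the number of rows suffices.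
syl : ℕ → List ℕ → List ℕ
syl (suc f) (suc zero ∷ ls)    = suc (length ls) ∷ []
syl (suc f) (suc (suc l) ∷ ls) = 2 + l + length ls ∷ suc l + length (down ls) ∷ syl f (down ls)
syl _       _                  = []

-- Let k be the number of rows recovered from `ms`. In `syl`, m′ is k plus the first row minus one,
-- which gives the first row. Moreover m exceeds `suc m′` by the number of rows that `down` dropped,
-- which is the argument c of `up`.
unsyl : List ℕ → List ℕ
unsyl []             = []
unsyl (m ∷ [])       = replicate m 1
unsyl (m ∷ m′ ∷ ms) = suc (m′ ∸ length (unsyl ms)) ∷ up (m ∸ suc m′) (unsyl ms)

syl-Strict : ∀ {b} f ls → length ls ≤ f → Desc b ls → Strict (b + length ls) (syl f ls)
syl-Strict zero    [] _ d = tt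
syl-Strict (suc f) [] _ d = tt
syl-Strict (suc f) (suc zero ∷ ls) (s≤s k≤f) (_ , l≤b , d) = s≤s z≤n , +-mono-≤ l≤b ≤-refl , tt
syl-Strict {b} (suc f) (suc (suc l) ∷ ls) (s≤s k≤f) (_ , l≤b , d) =
  s≤s z≤n , subst (_≤ b + suc (length ls)) (+-suc (2 + l) (length ls)) (+-monoˡ-≤ (suc (length ls)) l≤b) ,
  s≤s z≤n , s≤s (s≤s (+-monoʳ-≤ l (length-down ls))) ,
  syl-Strict f (down ls) (≤-trans (length-down ls) k≤f) (down-Desc ls d)

-- The two parts produced in one round account for the first row and the first column: every
-- remaining row with at least two boxes contributes 2, every row with a single box contributes 1,
-- just as much as `down` removes from the weight.
sum-syl : ∀ {b} f ls → length ls ≤ f → Desc b ls → sum (syl f ls) ≡ W ls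
sum-syl zero    [] _ d = refl
sum-syl (suc f) [] _ d = refl
sum-syl (suc f) (suc zero ∷ ls) (s≤s k≤f) (_ , _ , d) =
  cong suc (trans (+-identityʳ (length ls)) (trans (sym (W-ones (length ls))) (cong W (replicate-ones ls d))))
sum-syl (suc f) (suc (suc l) ∷ ls) (s≤s k≤f) (_ , _ , d) = begin
  2 + l + length ls + (suc l + k + sum (syl f rs))  ≡⟨ cong₂ (λ x y → 2 + l + x + (suc l + k + y)) length-ls ih ⟩
  2 + l + (k + c) + (suc l + k + W rs)              ≡⟨ arith l k c (W rs) ⟩
  oddPart (2 + l) + (W rs + k * 2 + c)              ≡⟨ cong (oddPart (2 + l) +_) (W-up c rs d′) ⟨
  oddPart (2 + l) + W (up c rs)                     ≡⟨ cong (λ ls → oddPart (2 + l) + W ls) (up-down ls d) ⟩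
  oddPart (2 + l) + W ls                            ∎
  where
  open ≡-Reasoning
  rs = down ls
  k = length rs
  c = length ls ∸ k
  d′ : Desc (suc l) rs
  d′ = down-Desc ls d
  ih = sum-syl f rs (≤-trans (length-down ls) k≤f) d′
  length-ls : length ls ≡ k + c
  length-ls = sym (m+[n∸m]≡n (length-down ls))
  arith : ∀ l k c w → 2 + l + (k + c) + (1 + l + k + w) ≡ 3 + l * 2 + (w + k * 2 + c)
  arith = solve-∀

unsyl-syl : ∀ {b} f ls → length ls ≤ f → Desc b ls → unsyl (syl f ls) ≡ ls
unsyl-syl zero    [] _ d = refl
unsyl-syl (suc f) [] _ d = refl
unsyl-syl (suc f) (suc zero ∷ ls) (s≤s k≤f) (_ , _ , d) = cong (1 ∷_) (replicate-ones ls d)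
unsyl-syl (suc f) (suc (suc l) ∷ ls) (s≤s k≤f) (_ , _ , d)
  rewrite unsyl-syl f (down ls) (≤-trans (length-down ls) k≤f) (down-Desc ls d) =
  cong₂ _∷_ (cong suc (m+n∸n≡m (suc l) (length (down ls))))
    (trans (cong (λ c → up c (down ls)) ([m+n]∸[m+o]≡n∸o l (length ls) (length (down ls)))) (up-down ls d))

-- The induction must bound the longest row plus the number of rows. Applied to `ms` below m′, this
-- makes m′ ∸ k a genuine subtraction and bounds the inner rows by it, so the new first row is long
-- enough.
unsyl-Desc : ∀ {b} ms → Strict b ms →
             length (unsyl ms) ≤ b × Desc (b ∸ length (unsyl ms)) (unsyl ms)
unsyl-Desc [] s = z≤n , tt
unsyl-Desc {b} (m ∷ []) (_ , m<b , _) rewrite length-replicate m {x = 1} =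
  <⇒≤ m<b , ones-Desc m (m<n⇒0<n∸m m<b)
unsyl-Desc {b} (m ∷ m′ ∷ ms) (_ , m<b , _ , m′<m , s) =
  m+n≤o⇒n≤o (suc q) total , s≤s z≤n , m+n≤o⇒m≤o∸n (suc q) total , up-Desc c rs d
  where
  rs = unsyl ms
  k = length rs
  q = m′ ∸ k
  c = m ∸ suc m′
  ih = unsyl-Desc ms s
  d = proj₂ ih
  arith : ∀ q k c → suc q + suc (k + c) ≡ suc (suc (k + q) + c)
  arith = solve-∀
  total : suc q + suc (length (up c rs)) ≤ b
  total = begin
    suc q + suc (length (up c rs)) ≡⟨ cong (λ x → suc q + suc x) (length-up c rs) ⟩
    suc q + suc (k + c)            ≡⟨ arith q k c ⟩
    suc (suc (k + q) + c)          ≡⟨ cong (λ x → suc (suc x + c)) (m+[n∸m]≡n (proj₁ ih)) ⟩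
    suc (suc m′ + c)               ≡⟨ cong suc (m+[n∸m]≡n m′<m) ⟩
    suc m                          ≤⟨ m<b ⟩
    b                              ∎
    where open ≤-Reasoning

syl-unsyl : ∀ {b} f ms → length (unsyl ms) ≤ f → Strict b ms → syl f (unsyl ms) ≡ ms
syl-unsyl zero    [] _ s = refl
syl-unsyl (suc f) [] _ s = refl
syl-unsyl zero    (suc m ∷ []) () s
syl-unsyl zero    (m ∷ m′ ∷ ms) () s
syl-unsyl (suc f) (suc m ∷ []) _ s = cong (λ k → suc k ∷ []) (length-replicate m)
syl-unsyl (suc f) (m ∷ m′ ∷ ms) (s≤s k≤f) (_ , _ , 1≤m′ , m′<m , s)
  with m′ ∸ length (unsyl ms) in eq | unsyl-Desc ms s
-- If m′ ∸ k were 0, the rows would be bounded by 0, so there would be none; then k = 0 and m′ = 0.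
... | zero  | k≤m′ , d = contradiction 1≤m′ (<⇒≱ (s≤s (subst (m′ ≤_) (nil-length (unsyl ms) d) (m∸n≡0⇒m≤n eq))))
  where
  nil-length : ∀ rs → Desc 0 rs → length rs ≡ 0
  nil-length []       _               = refl
  nil-length (r ∷ rs) (1≤r , r≤0 , _) = contradiction r≤0 (<⇒≱ 1≤r)
... | suc q | k≤m′ , d
  rewrite length-up (m ∸ suc m′) (unsyl ms) | down-up (m ∸ suc m′) (unsyl ms) d =
  cong₂ _∷_ eq₁ (cong₂ _∷_ eq₂ (syl-unsyl f ms (≤-trans (m≤m+n _ _) k≤f) s))
  where
  open ≡-Reasoning
  k = length (unsyl ms)
  c = m ∸ suc m′
  eq₂ : suc q + k ≡ m′
  eq₂ = trans (cong (_+ k) (sym eq)) (m∸n+n≡m k≤m′)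
  eq₁ : 2 + q + (k + c) ≡ m
  eq₁ = begin
    2 + q + (k + c)     ≡⟨ +-assoc (2 + q) k c ⟨
    suc (suc q + k) + c ≡⟨ cong (λ x → suc x + c) eq₂ ⟩
    suc m′ + c          ≡⟨ m+[n∸m]≡n m′<m ⟩
    m                   ∎

oddLength : List ℕ → Bool
oddLength []       = false
oddLength (x ∷ xs) = not (oddLength xs)

-- All rows up to the one on the diagonal have at least two boxes, so `down` keeps them; losing a
-- column lowers the offset by one.
down-Fix : ∀ {r ls} → Fix (suc (suc r)) ls → Fix (suc r) (down ls)
down-Fix hit                      = hit
down-Fix (step (s≤s (s≤s r<l)) f) = step (s≤s r<l) (down-Fix f)

down-NoFix : ∀ {r ls} → NoFix (suc (suc r)) ls → NoFix (suc r) (down ls)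
down-NoFix nil                          = nil
down-NoFix (stop {l = zero} _)          = nil
down-NoFix (stop {l = suc zero} _)      = nil
down-NoFix (stop {l = suc (suc l)} (s≤s l<r)) = stop l<r
down-NoFix (step (s≤s (s≤s r<l)) f)     = step (s≤s r<l) (down-NoFix f)

-- A round deletes the first row and the first column, hence moves along the diagonal and preserves
-- `Fix 1`, while producing two parts. It ends at a first row of length one, which gives a single
-- last part.
syl-Fix : ∀ f ls → length ls ≤ f → Fix 1 ls → oddLength (syl f ls) ≡ true
syl-Fix (suc f) _        _         hit                      = refl
syl-Fix (suc f) (_ ∷ ls) (s≤s k≤f) (step (s≤s (s≤s z≤n)) g) =
  trans (not-involutive _) (syl-Fix f (down ls) (≤-trans (length-down ls) k≤f) (down-Fix g))

syl-NoFix : ∀ f ls → length ls ≤ f → NoFix 1 ls → oddLength (syl f ls) ≡ false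
syl-NoFix zero    _ _ nil = refl
syl-NoFix (suc f) _ _ nil = refl
syl-NoFix (suc f) _ _ (stop (s≤s z≤n)) = refl
syl-NoFix (suc f) (_ ∷ ls) (s≤s k≤f) (step (s≤s (s≤s z≤n)) g) =
  trans (not-involutive _) (syl-NoFix f (down ls) (≤-trans (length-down ls) k≤f) (down-NoFix g))

sylvester : List ℕ → List ℕ
sylvester ls = syl (length ls) ls

IsDistinct : List ℕ → Set
IsDistinct ms = ∃[ b ] Strict b ms

sylvester-≅ : IsPart ≅ IsDistinct
sylvester-≅ = record
  { to = sylvester
  ; from = unsyl
  ; to-ok = λ { {ls} (b , d) → _ , syl-Strict _ ls ≤-refl d }
  ; from-ok = λ { {ms} (b , s) → _ , proj₂ (unsyl-Desc ms s) }
  ; from-to = λ { {ls} (b , d) → unsyl-syl _ ls ≤-refl d }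
  ; to-from = λ { {ms} (b , s) → syl-unsyl _ ms ≤-refl s } }

W-unsyl : ∀ {b} ms → Strict b ms → W (unsyl ms) ≡ sum ms
W-unsyl ms s = trans (sym (sum-syl _ (unsyl ms) ≤-refl (proj₂ (unsyl-Desc ms s))))
                     (cong sum (syl-unsyl _ ms ≤-refl s))

-- The involution that moves the largest part.

-- Ties are moved out of the second list: it must stay strictly decreasing, whereas the first may
-- repeat a part. The moved part is then the one that a second application moves back.
toggle : List ℕ × List ℕ → List ℕ × List ℕ
toggle ([]    , [])    = [] , []
toggle (x ∷ a , [])    = a , x ∷ []
toggle ([]    , y ∷ d) = y ∷ [] , d
toggle (x ∷ a , y ∷ d) with y <? x
... | yes _ = a , x ∷ y ∷ d
... | no  _ = y ∷ x ∷ a , d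

IsPair : List ℕ × List ℕ → Set
IsPair (a , d) = IsPart a × IsDistinct d

toggle-IsPair : ∀ {p} → IsPair p → IsPair (toggle p)
toggle-IsPair {[]    , []}    _ = (0 , tt) , (0 , tt)
toggle-IsPair {x ∷ a , []}    ((_ , 1≤x , _ , da) , _) = (x , da) , (suc x , 1≤x , ≤-refl , tt)
toggle-IsPair {[]    , y ∷ d} (_ , (_ , 1≤y , _ , sd)) = (y , 1≤y , ≤-refl , tt) , (y , sd)
toggle-IsPair {x ∷ a , y ∷ d} ((_ , 1≤x , _ , da) , (_ , 1≤y , _ , sd)) with y <? x
... | yes y<x = (x , da) , (suc x , 1≤x , ≤-refl , 1≤y , y<x , sd)
... | no  y≮x = (y , 1≤y , ≤-refl , 1≤x , ≮⇒≥ y≮x , da) , (y , sd)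

toggle-∷ˡ : ∀ {x} a d → Strict x d → toggle (x ∷ a , d) ≡ (a , x ∷ d)
toggle-∷ˡ a [] s = refl
toggle-∷ˡ {x} a (y ∷ d) (_ , y<x , _) with y <? x
... | yes _  = refl
... | no y≮x = contradiction y<x y≮x

toggle-∷ʳ : ∀ {y} a d → Desc y a → toggle (a , y ∷ d) ≡ (y ∷ a , d)
toggle-∷ʳ [] d _ = refl
toggle-∷ʳ {y} (x ∷ a) d (_ , x≤y , _) with y <? x
... | yes y<x = contradiction x≤y (<⇒≱ y<x)
... | no _    = refl

toggle-involutive : ∀ {p} → IsPair p → toggle (toggle p) ≡ p
toggle-involutive {[]    , []}    _ = refl
toggle-involutive {x ∷ a , []}    ((_ , _ , _ , da) , _) = toggle-∷ʳ a [] da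
toggle-involutive {[]    , y ∷ d} (_ , (_ , _ , _ , sd)) = toggle-∷ˡ [] d sd
toggle-involutive {x ∷ a , y ∷ d} ((_ , _ , _ , da) , (_ , _ , _ , sd)) with y <? x
... | yes y<x = toggle-∷ʳ a (y ∷ d) da
... | no  y≮x = toggle-∷ˡ (x ∷ a) d sd

sum₂ : List ℕ × List ℕ → ℕ
sum₂ (a , d) = sum a + sum d

toggle-sum : ∀ p → sum₂ (toggle p) ≡ sum₂ p
toggle-sum ([]    , [])    = refl
toggle-sum (x ∷ a , [])    = arith x (sum a)
  where
  arith : ∀ x a → a + (x + 0) ≡ x + a + 0
  arith = solve-∀
toggle-sum ([]    , y ∷ d) = cong (_+ sum d) (+-identityʳ y)
toggle-sum (x ∷ a , y ∷ d) with y <? x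
... | yes _ = arith x y (sum a) (sum d)
  where
  arith : ∀ x y a d → a + (x + (y + d)) ≡ x + a + (y + d)
  arith = solve-∀
... | no _ = arith x y (sum a) (sum d)
  where
  arith : ∀ x y a d → y + (x + a) + d ≡ x + a + (y + d)
  arith = solve-∀

toggle-oddLength : ∀ p → 1 ≤ sum₂ p → oddLength (proj₂ (toggle p)) ≡ not (oddLength (proj₂ p))
toggle-oddLength (x ∷ a , [])    _ = refl
toggle-oddLength ([]    , y ∷ d) _ = sym (not-involutive _)
toggle-oddLength (x ∷ a , y ∷ d) _ with y <? x
... | yes _ = refl
... | no _  = sym (not-involutive _)

transfer : Triple → Triple
transfer (a , l , e) = let (a′ , d′) = toggle (a , sylvester l) in a′ , unsyl d′ , e

module _ {a l : List ℕ} (pa : IsPart a) (pl : IsPart l) where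

  private
    ad = toggle (a , sylvester l)
    pair : IsPair ad
    pair = toggle-IsPair (pa , _≅_.to-ok sylvester-≅ pl)
    l′ = unsyl (proj₂ ad)
    sylvester-l′ : sylvester l′ ≡ proj₂ ad
    sylvester-l′ = _≅_.to-from sylvester-≅ (proj₂ pair)

  transfer-IsPart : IsPart (proj₁ ad) × IsPart l′
  transfer-IsPart = proj₁ pair , _≅_.from-ok sylvester-≅ (proj₂ pair)

  transfer-weight : sum (proj₁ ad) + W l′ ≡ sum a + W l
  transfer-weight = begin
    sum (proj₁ ad) + W l′        ≡⟨ cong (sum (proj₁ ad) +_) (W-unsyl (proj₂ ad) (proj₂ (proj₂ pair))) ⟩
    sum₂ ad                      ≡⟨ toggle-sum (a , sylvester l) ⟩
    sum a + sum (sylvester l)   ≡⟨ cong (sum a +_) (sum-syl _ l ≤-refl (proj₂ pl)) ⟩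
    sum a + W l                 ∎
    where open ≡-Reasoning

  transfer-weight-+ : ∀ s → sum (proj₁ ad) + (W l′ + s) ≡ sum a + (W l + s)
  transfer-weight-+ s = begin
    sum (proj₁ ad) + (W l′ + s) ≡⟨ +-assoc (sum (proj₁ ad)) (W l′) s ⟨
    sum (proj₁ ad) + W l′ + s   ≡⟨ cong (_+ s) transfer-weight ⟩
    sum a + W l + s             ≡⟨ +-assoc (sum a) (W l) s ⟩
    sum a + (W l + s)           ∎
    where open ≡-Reasoning

  transfer-involutive : ∀ {e} → transfer (transfer (a , l , e)) ≡ (a , l , e)
  transfer-involutive {e}
    rewrite sylvester-l′ | toggle-involutive {a , sylvester l} (pa , _≅_.to-ok sylvester-≅ pl) =
    cong (λ l → a , l , e) (_≅_.from-to sylvester-≅ pl)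

  transfer-oddLength : 1 ≤ sum a + W l → oddLength (sylvester l′) ≡ not (oddLength (sylvester l))
  transfer-oddLength pos rewrite sylvester-l′ =
    toggle-oddLength (a , sylvester l) (subst (1 ≤_) (cong (sum a +_) (sym (sum-syl _ l ≤-refl (proj₂ pl)))) pos)

  transfer-NoFix : 1 ≤ sum a + W l → Fix 1 l → NoFix 1 l′
  transfer-NoFix pos f with fix? 1 l′
  ... | inj₂ g = g
  ... | inj₁ g with () ← trans (sym (syl-Fix _ l′ ≤-refl g))
      (trans (transfer-oddLength pos) (cong not (syl-Fix _ l ≤-refl f)))

  transfer-Fix : 1 ≤ sum a + W l → NoFix 1 l → Fix 1 l′
  transfer-Fix pos f with fix? 1 l′
  ... | inj₁ g = g
  ... | inj₂ g with () ← trans (sym (syl-NoFix _ l′ ≤-refl g))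
      (trans (transfer-oddLength pos) (cong not (syl-NoFix _ l ≤-refl f)))

Fix⇒W>0 : ∀ {l} → Fix 1 l → 1 ≤ W l
Fix⇒W>0 hit                  = s≤s z≤n
Fix⇒W>0 (step (s≤s r<l) f) = s≤s z≤n

-- Weight zero means that `a` and `l` are empty, the one case in which `toggle` has nothing to move
-- and parity is not reversed.
PosTriple ZeroTriple : ℕ → Triple → Set
PosTriple n t@(a , l , e) = NoFixTriple 0 n t × 1 ≤ sum a + W l
ZeroTriple n t@(a , l , e) = IsTriple n t × sum a + W l ≡ 0

transfer-≅ : ∀ n → PosTriple n ≅ FixTriple 0 n
transfer-≅ n = record
  { to = transfer
  ; from = transfer
  ; to-ok = λ { {a , l , e} ((((pa , pl , pe , s) , _) , f) , pos) →
      let pa′ , pl′ = transfer-IsPart pa pl in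
      ((pa′ , pl′ , pe , trans (transfer-weight-+ pa pl (sum e * 2)) s) , λ ()) , transfer-Fix pa pl pos f }
  ; from-ok = λ { {a , l , e} (((pa , pl , pe , s) , _) , f) →
      let pa′ , pl′ = transfer-IsPart pa pl
          pos = ≤-trans (Fix⇒W>0 f) (m≤n+m (W l) (sum a)) in
      (((pa′ , pl′ , pe , trans (transfer-weight-+ pa pl (sum e * 2)) s) , λ ()) , transfer-NoFix pa pl pos f)
      , subst (1 ≤_) (sym (transfer-weight pa pl)) pos }
  ; from-to = λ { ((((pa , pl , _) , _) , _) , _) → transfer-involutive pa pl }
  ; to-from = λ { (((pa , pl , _) , _) , _) → transfer-involutive pa pl } }

IsHalf : ℕ → List ℕ → Set
IsHalf n e = IsPart e × sum e * 2 ≡ n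

Zero-≅ : ∀ n → IsHalf n ≅ ZeroTriple n
Zero-≅ n = record
  { to = λ e → [] , [] , e
  ; from = λ (a , l , e) → e
  ; to-ok = λ (pe , s) → ((0 , tt) , (0 , tt) , pe , s) , refl
  ; from-ok = λ { {a , l , e} ((_ , _ , pe , s) , z) →
      pe , trans (cong (_+ sum e * 2) (sym z)) (trans (+-assoc (sum a) (W l) _) s) }
  ; from-to = λ _ → refl
  ; to-from = λ { {a , l , e} (((_ , da) , (_ , dl) , _) , z) →
      cong₂ (λ a l → a , l , e) (sym (sum-zero a da (m+n≡0⇒m≡0 (sum a) z)))
                                (sym (W-zero l dl (m+n≡0⇒n≡0 (sum a) z))) } }
  where
  sum-zero : ∀ {b} a → Desc b a → sum a ≡ 0 → a ≡ []
  sum-zero []          d z = refl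
  sum-zero (zero ∷ a)  (() , _)
  W-zero : ∀ {b} l → Desc b l → W l ≡ 0 → l ≡ []
  W-zero []         d z = refl
  W-zero (zero ∷ l) (() , _)

-- The recurrence and its initial case.

card-Has : ∀ μ n → Card (HasTriple μ (μ * μ + n)) (pp n)
card-Has zero n = Card-≅ (⇔⇒≅ (λ t → t , λ ()) proj₁)
  (Card-≅ (split-≅ n) (bipartitions n , bipartitions-enum n , refl))
card-Has (suc μ) n = subst (λ m → Card (HasTriple (suc μ) m) (pp n)) (arith μ n)
  (Card-≅ (insert-≅ μ (μ * μ + n)) (card-Has μ n))
  where
  arith : ∀ μ n → suc (μ * 2) + (μ * μ + n) ≡ suc μ * suc μ + n
  arith = solve-∀

card-NoFix : ∀ ν n → Card (NoFixTriple (suc ν) n) (ppe ν n)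
card-NoFix ν n = Card-≅ bij
  (_ , Enum-filter (λ b → T? (ppe-ok ν b)) (bipartitions-enum n) , refl)
  where
  module S = _≅_ (split-≅ n)
  bij : (λ b → IsBipart n b × T (ppe-ok ν b)) ≅ NoFixTriple (suc ν) n
  bij = record
    { to = split
    ; from = unsplit
    ; to-ok = λ { {xs , ys} (b , ok) →
        let t@(_ , (_ , d) , _) = S.to-ok b
            has , f = M-ok⇒ ν ys d ok in (t , has) , f }
    ; from-ok = λ { {a , l , e} ((t@(_ , (_ , d) , _) , has) , f) →
        S.from-ok t ,
        let eq = sym (rows-join l e d) in
        ⇒M-ok ν (join l e) (subst (Desc _) eq d)
          (λ {j} j<ν → subst (suc j ∈_) eq (has j<ν)) (subst (NoFix _) eq f) }
    ; from-to = λ (b , _) → S.from-to b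
    ; to-from = λ ((t , _) , _) → S.to-from t }

-- In the notation c(μ), `ppe ν` is c(ν + 1); the promotion bijection shows that it also counts the
-- triples at level ν with a row on the diagonal.
card-Fix : ∀ ν n → Card (FixTriple ν n) (ppe ν n)
card-Fix ν n = Card-≅ (≅-sym (promote-≅ ν n)) (card-NoFix ν n)

pp-ppe : ∀ ν n → ppe ν (suc ν * suc ν + n) + ppe (suc ν) (suc ν * suc ν + n) ≡ pp n
pp-ppe ν n = Card-unique
  (Card-≅ (⇔⇒≅ (λ { (inj₁ (t , _)) → t ; (inj₂ (t , _)) → t }) split′)
    (Card-∪ (λ (_ , f) (_ , g) → Fix⇒¬NoFix g f) (card-NoFix ν _) (card-Fix (suc ν) _)))
  (card-Has (suc ν) n)
  where
  N = suc ν * suc ν + n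
  split′ : ∀ {t} → HasTriple (suc ν) N t → NoFixTriple (suc ν) N t ⊎ FixTriple (suc ν) N t
  split′ {a , l , e} t with fix? (suc (suc ν)) l
  ... | inj₁ f = inj₂ (t , f)
  ... | inj₂ f = inj₁ (t , f)

-- All triples fall into three classes: those with a row on the diagonal, their images under
-- `transfer`, and those of weight zero outside the even parts. The first two are equinumerous, and
-- E counts the third.
pp-ppe₀ : ∀ {E} n → Card (IsHalf n) E → ppe 0 n + (ppe 0 n + E) ≡ pp n
pp-ppe₀ n half = Card-unique
  (Card-≅ (⇔⇒≅ forget split′)
    (Card-∪ disj (card-Fix 0 n)
      (Card-∪ (λ { (_ , pos) (_ , z) → contradiction z (>⇒≢ pos) })
        (Card-≅ (≅-sym (transfer-≅ n)) (card-Fix 0 n)) (Card-≅ (Zero-≅ n) half))))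
  (card-Has 0 n)
  where
  forget : ∀ {t} → FixTriple 0 n t ⊎ (PosTriple n t ⊎ ZeroTriple n t) → HasTriple 0 n t
  forget (inj₁ (t , _))              = t
  forget (inj₂ (inj₁ ((t , _) , _))) = t
  forget (inj₂ (inj₂ (t , _)))       = t , λ ()
  disj : ∀ {t} → FixTriple 0 n t → ¬ (PosTriple n t ⊎ ZeroTriple n t)
  disj (_ , f) (inj₁ ((_ , g) , _)) = Fix⇒¬NoFix f g
  disj {a , l , e} (_ , f) (inj₂ (_ , z)) = contradiction (m+n≡0⇒n≡0 (sum a) z) (>⇒≢ (Fix⇒W>0 f))
  split′ : ∀ {t} → HasTriple 0 n t → FixTriple 0 n t ⊎ (PosTriple n t ⊎ ZeroTriple n t)
  split′ {a , l , e} t with fix? 1 l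
  ... | inj₁ f = inj₁ (t , f)
  ... | inj₂ f with 1 ≤? sum a + W l
  ...   | yes pos = inj₂ (inj₁ ((t , f) , pos))
  ...   | no ¬pos = inj₂ (inj₂ (proj₁ t , n<1⇒n≡0 (≰⇒> ¬pos)))

card-even : ∀ n → Card (IsHalf (2 * n)) (p n)
card-even n = Card-≅ (⇔⇒≅ (λ { {e} (pe , refl) → pe , *-comm (sum e) 2 })
    (λ { {e} (pe , s) → pe , *-cancelʳ-≡ (sum e) n 2 (trans s (*-comm 2 n)) }))
  (partitions n , partitions-enum n , refl)

card-odd : ∀ n → Card (IsHalf (2 * n + 1)) 0
card-odd n = [] , record
  { unique = [] ; sound = λ () ; complete = λ { {e} (_ , s) → ⊥-elim (absurd (sum e) s) } } , refl
  where
  absurd : ∀ k → k * 2 ≢ 2 * n + 1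
  absurd k s = even≢odd k n (trans (*-comm 2 k) (trans s (+-comm (2 * n) 1)))

-- The alternating sums.

-- Opened only here: with +_ in scope, sections such as (x +_) are ambiguous.
open import Data.Integer using (ℤ; +_; -_) renaming (_+_ to _+ℤ_; _*_ to _*ℤ_; _^_ to _^ℤ_)

sign-square : ∀ ν → (- + 1) ^ℤ ν *ℤ (- + 1) ^ℤ ν ≡ + 1
sign-square zero    = refl
sign-square (suc ν) = trans (arith ((- + 1) ^ℤ ν)) (sign-square ν)
  where
  arith : ∀ s → (- + 1 *ℤ s) *ℤ (- + 1 *ℤ s) ≡ s *ℤ s
  arith = ℤSolver.solve-∀

-- Both parities are treated together: E is p(N/2) for even N and 0 for odd N. Passing from ν to ν +
-- 1 negates the left side and adds 2 pp(N - (ν + 1)²), which is 2c + 2c′ by the recurrence; the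
-- term 2c cancels, leaving 2c′.
truncated : ∀ N E → Card (IsHalf N) E → ∀ ν → ν * ν ≤ N →
  (- + 1) ^ℤ ν *ℤ (+ pp N +ℤ (+ 2) *ℤ sum1to ν (λ τ → (- + 1) ^ℤ τ *ℤ + pp (N ∸ τ * τ)))
    ≡ (- + 1) ^ℤ ν *ℤ + E +ℤ (+ 2) *ℤ + ppe ν N
truncated N E half zero _ = begin
  + 1 *ℤ (+ pp N +ℤ + 0)                     ≡⟨ cong (λ k → + 1 *ℤ (+ k +ℤ + 0)) (pp-ppe₀ N half) ⟨
  + 1 *ℤ (+ (c + (c + E)) +ℤ + 0)            ≡⟨ cong (λ k → + 1 *ℤ (k +ℤ + 0))
                                                  (trans (ℤ.pos-+ c (c + E)) (cong (+ c +ℤ_) (ℤ.pos-+ c E))) ⟩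
  + 1 *ℤ (+ c +ℤ (+ c +ℤ + E) +ℤ + 0)        ≡⟨ arith (+ c) (+ E) ⟩
  + 1 *ℤ + E +ℤ + 2 *ℤ + c                   ∎
  where
  open ≡-Reasoning
  c = ppe 0 N
  arith : ∀ c e → + 1 *ℤ (c +ℤ (c +ℤ e) +ℤ + 0) ≡ + 1 *ℤ e +ℤ + 2 *ℤ c
  arith = ℤSolver.solve-∀
truncated N E half (suc ν) ν²≤N = begin
  (- + 1 *ℤ s) *ℤ (P₀ +ℤ + 2 *ℤ (S +ℤ (- + 1 *ℤ s) *ℤ + pp (N ∸ suc ν * suc ν)))
    ≡⟨ cong (λ k → (- + 1 *ℤ s) *ℤ (P₀ +ℤ + 2 *ℤ (S +ℤ (- + 1 *ℤ s) *ℤ k))) recurrence ⟩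
  (- + 1 *ℤ s) *ℤ (P₀ +ℤ + 2 *ℤ (S +ℤ (- + 1 *ℤ s) *ℤ (c +ℤ c′)))
    ≡⟨ arith₁ s P₀ S c c′ ⟩
  - (s *ℤ (P₀ +ℤ + 2 *ℤ S)) +ℤ + 2 *ℤ (s *ℤ s) *ℤ (c +ℤ c′)
    ≡⟨ cong₂ (λ x y → - x +ℤ + 2 *ℤ y *ℤ (c +ℤ c′))
         (truncated N E half ν (≤-trans (*-mono-≤ (n≤1+n ν) (n≤1+n ν)) ν²≤N)) (sign-square ν) ⟩
  - (s *ℤ + E +ℤ + 2 *ℤ c) +ℤ + 2 *ℤ + 1 *ℤ (c +ℤ c′)
    ≡⟨ arith₂ s (+ E) c c′ ⟩
  (- + 1 *ℤ s) *ℤ + E +ℤ + 2 *ℤ c′ ∎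
  where
  open ≡-Reasoning
  s = (- + 1) ^ℤ ν
  P₀ = + pp N
  S = sum1to ν (λ τ → (- + 1) ^ℤ τ *ℤ + pp (N ∸ τ * τ))
  c = + ppe ν N
  c′ = + ppe (suc ν) N
  recurrence : + pp (N ∸ suc ν * suc ν) ≡ c +ℤ c′
  recurrence = trans (cong +_ (trans (sym (pp-ppe ν (N ∸ suc ν * suc ν)))
      (cong (λ n → ppe ν n + ppe (suc ν) n) (m+[n∸m]≡n ν²≤N)))) (ℤ.pos-+ (ppe ν N) (ppe (suc ν) N))
  arith₁ : ∀ s P S c c′ → (- + 1 *ℤ s) *ℤ (P +ℤ + 2 *ℤ (S +ℤ (- + 1 *ℤ s) *ℤ (c +ℤ c′)))
                          ≡ - (s *ℤ (P +ℤ + 2 *ℤ S)) +ℤ + 2 *ℤ (s *ℤ s) *ℤ (c +ℤ c′)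
  arith₁ = ℤSolver.solve-∀
  arith₂ : ∀ s E c c′ → - (s *ℤ E +ℤ + 2 *ℤ c) +ℤ + 2 *ℤ + 1 *ℤ (c +ℤ c′) ≡ (- + 1 *ℤ s) *ℤ E +ℤ + 2 *ℤ c′
  arith₂ = ℤSolver.solve-∀

theorem1p8 : (ν n : ℕ) → 1 ≤ ν → (ν + 1) * (ν + 1) ≤ n →
    ((- + 1) ^ℤ ν *ℤ (+ pp (2 * n) +ℤ (+ 2) *ℤ sum1to ν (λ τ → (- + 1) ^ℤ τ *ℤ + pp (2 * n ∸ τ * τ)))
    ≡ (- + 1) ^ℤ ν *ℤ + p n +ℤ (+ 2) *ℤ + ppe ν (2 * n))
    × ((- + 1) ^ℤ ν *ℤ (+ pp (2 * n + 1) +ℤ (+ 2) *ℤ sum1to ν (λ τ → (- + 1) ^ℤ τ *ℤ + pp (2 * n + 1 ∸ τ * τ)))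
    ≡ (+ 2) *ℤ + ppe ν (2 * n + 1))
theorem1p8 ν n _ ν²≤n =
    truncated (2 * n) (p n) (card-even n) ν bound
  , trans (truncated (2 * n + 1) 0 (card-odd n) ν (≤-trans bound (m≤m+n (2 * n) 1)))
          (trans (cong (_+ℤ + 2 *ℤ + ppe ν (2 * n + 1)) (ℤ.*-zeroʳ ((- + 1) ^ℤ ν))) (ℤ.+-identityˡ _))
  where
  bound : ν * ν ≤ 2 * n
  bound = ≤-trans (≤-trans (*-mono-≤ (m≤m+n ν 1) (m≤m+n ν 1)) ν²≤n) (m≤m+n n (n + 0))
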